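{- Let $r \ge 2$ be an integer, let $E$ be the (finite) set of edges of some $r$-uniform hypergraph, and let $n > 1$ be a rational number. Then the simplicial complex $X = \{E' \subseteq E:\ \nu^*(E') < n\}$ on the vertex set $E$ is $(\lceil rn \rceil - 1)$-collapsible.
   Context: An $r$-uniform hypergraph has edges that are $r$-element subsets of a finite vertex set. For a set $E'$ of edges, $\nu^*(E')$ is the maximum of $\sum_{e\in E'} f(e)$ over functions $f\colon E'\to\mathbb{R}_{\ge0}$ with $\sum_{e\in E',\,e\ni v} f(e)\le 1$ for every vertex $v$ (the fractional matching number). A simplicial complex is a family of subsets closed under taking subsets; a facet is an inclusion-maximal face. For a positive integer $d$: if $\sigma$ is a face of $X$ contained in a unique facet of $X$ and $|\sigma| \le d$, removing $\sigma$ and all faces containing it is an elementary $d$-collapse; $X$ is $d$-collapsible if a finite sequence of elementary $d$-collapses reduces $X$ to $\{\emptyset\}$.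
   Formalization: The functions f in the definition of ν* take rational rather than real values, so ν*(E') < n means every rational fractional matching of E' has weight below n; this agrees with the real definition because a linear program with rational data has a rational optimum. -}

module Defs where

open import Data.Nat using (ℕ; zero; suc)
open import Data.Bool using (Bool; true; false; if_then_else_)
open import Data.Fin using (Fin; zero; suc)
open import Data.Fin.Subset using (Subset; _⊆_; ∣_∣; ⊥)
open import Data.Vec using (lookup)
open import Data.Rational using (ℚ; 0ℚ; 1ℚ; _+_; _*_; _≤_; _<_; _/_; ceiling)
open import Data.Integer using (ℤ; +_; _-_)
import Data.Integer as ℤ
open import Data.Product using (_×_; Σ-syntax)
open import Function.Bundles using (_⇔_)
open import Function.Definitions using (Injective)
open import Relation.Binary.PropositionalEquality using (_≡_)
open import Relation.Nullary using (¬_)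

Σℚ : (k : ℕ) → (Fin k → ℚ) → ℚ
Σℚ zero    f = 0ℚ
Σℚ (suc k) f = f zero + Σℚ k (λ i → f (suc i))

ΣOver : {k : ℕ} → Subset k → (Fin k → ℚ) → ℚ
ΣOver {k} S f = Σℚ k (λ i → if lookup S i then f i else 0ℚ)

record UniformHypergraph (r m k : ℕ) : Set where
  field
    edge     : Fin k → Subset m
    distinct : Injective _≡_ _≡_ edge
    uniform  : ∀ i → ∣ edge i ∣ ≡ r

IsFractionalMatching : {r m k : ℕ} → UniformHypergraph r m k → Subset k → (Fin k → ℚ) → Set
IsFractionalMatching {m = m} H E' f =
  (∀ i → 0ℚ ≤ f i) ×
  (∀ (v : Fin m) → ΣOver E' (λ i → if lookup (UniformHypergraph.edge H i) v then f i else 0ℚ) ≤ 1ℚ)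

-- ν*(E') < n : every fractional matching of E' has weight < n.
-- (ν* is a maximum, so ν*(E') < n iff every feasible f has value < n.)
FracMatchLess : {r m k : ℕ} → UniformHypergraph r m k → Subset k → ℚ → Set
FracMatchLess H E' n = ∀ f → IsFractionalMatching H E' f → ΣOver E' f < n

Complex : ℕ → Set₁
Complex k = Subset k → Set

IsFacet : {k : ℕ} → Complex k → Subset k → Set
IsFacet X τ = X τ × (∀ ρ → X ρ → τ ⊆ ρ → ρ ≡ τ)

IsTrivial : {k : ℕ} → Complex k → Set
IsTrivial X = ∀ ρ → (X ρ ⇔ (ρ ≡ ⊥))

Remove : {k : ℕ} → Complex k → Subset k → Complex k
Remove X σ ρ = X ρ × ¬ (σ ⊆ ρ)

data Collapsible {k : ℕ} (d : ℤ) : Complex k → Set₁ where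
  done : ∀ {X} → IsTrivial X → Collapsible d X
  step : ∀ {X} (σ τ : Subset k) →
         X σ →
         (+ ∣ σ ∣) ℤ.≤ d →
         IsFacet X τ → σ ⊆ τ →
         (∀ τ′ → IsFacet X τ′ → σ ⊆ τ′ → τ′ ≡ τ) →
         Collapsible d (Remove X σ) →
         Collapsible d X

LowMatchingComplex : {r m k : ℕ} → UniformHypergraph r m k → ℚ → Complex k
LowMatchingComplex H n E' = FracMatchLess H E' n

collapseDim : ℕ → ℚ → ℤ
collapseDim r n = ceiling (((+ r) / 1) * n) - (+ 1)

module Submission where

-- Perturb the vertex capacities to c ≥ 1 and the edge weights to b ≥ 1, generically and so slightly
-- that ν*(A) < n is still equivalent to val A < n, where val A is the maximum of b·f over the
-- f ≥ 0 supported on A with Mf ≤ c (M is the incidence matrix). For generic b and c an optimum f is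
-- unique and nondegenerate: if σ is its support and T its set of saturated vertices, then the block
-- of M with rows T and columns σ is invertible. Hence |σ| = |T| ≤ Σ_{v ∈ T} c_v ≤ r Σ f ≤ r val A < r n.
-- The dual solution w supported on T is determined by f, so the sets with optimum f are exactly those
-- between σ and {e : b_e ≤ (wM)_e}. These intervals partition the complex, and removing them
-- in order of decreasing val is a sequence of elementary collapses.

open import Defs
open import Data.Bool using (Bool; true; false; not; if_then_else_)
import Data.Bool.Properties as Bool
open import Data.Empty using (⊥-elim)
open import Data.Fin using (Fin; zero; suc)
import Data.Fin.Properties as Fin
open import Data.Fin.Subset using (Subset; _⊆_; ∣_∣; ⊥)
open import Data.Fin.Subset.Properties using (⊆-antisym; _⊆?_; nonempty?; Empty-unique)
open import Data.Integer using (ℤ)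
import Data.Integer as ℤ
import Data.Integer.DivMod as ℤ
import Data.Integer.Properties as ℤ
open import Data.List as List using (List; []; _∷_; _++_; map; length; filter; cartesianProduct)
import Data.List.Extrema
open import Data.List.Membership.Propositional using (_∈_; lose)
open import Data.List.Membership.Propositional.Properties
  using (∈-filter⁺; ∈-filter⁻; ∈-map⁺; ∈-++⁺ˡ; ∈-++⁺ʳ; ∈-cartesianProduct⁺)
open import Data.List.Properties using (filter-notAll)
open import Data.List.Relation.Unary.All as All using (All; []; _∷_)
import Data.List.Relation.Unary.All.Properties as All
import Data.List.Relation.Unary.Any as Any
import Data.Nat as ℕ
import Data.Nat.Properties as ℕ
open import Data.Nat using (ℕ; zero; suc; s≤s)
open import Data.Nat.Coprimality using (1-coprimeTo) renaming (sym to coprime-sym)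
open import Data.Product using (_×_; _,_; ∃-syntax; proj₁; proj₂)
open import Data.Rational hiding (∣_∣)
open import Data.Rational.Properties
open import Data.Sum using (_⊎_; inj₁; inj₂; [_,_]′)
open import Data.Vec using ([]; _∷_; lookup; tabulate)
import Data.Vec.Properties as Vec
open import Data.Vec.Properties using (lookup∘tabulate; tabulate-cong; []=⇒lookup; lookup⇒[]=)
open import Function using (_∘_; id; flip)
open import Function.Bundles using (_⇔_; mk⇔; Equivalence)
open import Relation.Binary.Bundles using (DecTotalOrder)
open import Relation.Binary.Definitions using (DecidableEquality; tri<; tri≈; tri>)
open import Relation.Binary.PropositionalEquality
open import Relation.Nullary using (¬_; yes; no; does; Dec)
open import Relation.Nullary.Decidable
  using (_→-dec_; decidable-stable; dec-true; dec-false; dec⇒maybe; ¬?; toSum)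
open import Tactic.RingSolver using (solve-∀)
open import Tactic.RingSolver.Core.AlmostCommutativeRing using (AlmostCommutativeRing; fromCommutativeRing)

-- For ν* itself the optimum of a set and its dual solution may fail to be unique, so a set has no
-- canonical smallest subset or largest superset with the same optimum; the perturbation supplies
-- both. Only finitely many blocks (T, σ) exist, so b and c merely have to avoid finitely many
-- hyperplanes, and one nonzero kernel vector per singular block is enough: degeneracy at an optimum
-- would make every kernel vector orthogonal to b, or to c on the dual side. Both perturbations go
-- upwards from 1 because the size estimate uses 1 ≤ c_v on saturated vertices and Σ f ≤ b·f. Taking
-- the largest value first works because a remaining face above σ has at least the value of σ, hence
-- exactly that value, hence by uniqueness the same optimum, hence lies in the same interval; the
-- top of that interval is then the only facet above σ. Ties in val between different intervals do
-- no harm. The bound |σ| < rn is strict, which accounts for the -1 in the collapse dimension.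

private variable
  k m n : ℕ

-- Arithmetic in the ordered field of rationals

ℚ-ring : AlmostCommutativeRing _ _
ℚ-ring = fromCommutativeRing +-*-commutativeRing (λ p → dec⇒maybe (0ℚ ≟ p))

≤⇒0≤- : ∀ {p q} → p ≤ q → 0ℚ ≤ q - p
≤⇒0≤- {p} {q} p≤q = subst (_≤ q - p) (+-inverseʳ p) (+-monoˡ-≤ (- p) p≤q)

0≤-⇒≤ : ∀ {p q} → 0ℚ ≤ q - p → p ≤ q
0≤-⇒≤ {p} {q} h = subst₂ _≤_ (+-identityˡ p) (cancel q p) (+-monoˡ-≤ p h)
  where
  cancel : ∀ q p → q - p + p ≡ q
  cancel = solve-∀ ℚ-ring

<⇒0<- : ∀ {p q} → p < q → 0ℚ < q - p
<⇒0<- {p} {q} p<q = subst (_< q - p) (+-inverseʳ p) (+-monoˡ-< (- p) p<q)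

0≤*0≤ : ∀ {p q} → 0ℚ ≤ p → 0ℚ ≤ q → 0ℚ ≤ p * q
0≤*0≤ {p} {q} 0≤p 0≤q = subst (_≤ p * q) (*-zeroʳ p) (*-monoˡ-≤-nonNeg p {{nonNegative 0≤p}} 0≤q)

0<*0< : ∀ {p q} → 0ℚ < p → 0ℚ < q → 0ℚ < p * q
0<*0< {p} {q} 0<p 0<q = subst (_< p * q) (*-zeroʳ p) (*-monoʳ-<-pos p {{positive 0<p}} 0<q)

0≤+0≤ : ∀ {p q} → 0ℚ ≤ p → 0ℚ ≤ q → 0ℚ ≤ p + q
0≤+0≤ = +-mono-≤

*-monoˡ : ∀ {r p q} → 0ℚ ≤ r → p ≤ q → r * p ≤ r * q
*-monoˡ {r} 0≤r = *-monoˡ-≤-nonNeg r {{nonNegative 0≤r}}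

*-monoʳ : ∀ {r p q} → 0ℚ ≤ r → p ≤ q → p * r ≤ q * r
*-monoʳ {r} 0≤r = *-monoʳ-≤-nonNeg r {{nonNegative 0≤r}}

*-≢0 : ∀ {p q} → p ≢ 0ℚ → q ≢ 0ℚ → p * q ≢ 0ℚ
*-≢0 {p} {q} p≢0 q≢0 pq≡0 = q≢0 (begin
  q                                    ≡⟨ *-identityˡ q ⟨
  1ℚ * q                               ≡⟨ cong (_* q) (*-inverseˡ p) ⟨
  (1/ p) * p * q                       ≡⟨ *-assoc (1/ p) p q ⟩
  (1/ p) * (p * q)                     ≡⟨ cong ((1/ p) *_) pq≡0 ⟩
  (1/ p) * 0ℚ                          ≡⟨ *-zeroʳ (1/ p) ⟩
  0ℚ                                   ∎)
  where
  open ≡-Reasoning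
  instance
    p-nonZero : NonZero p
    p-nonZero = ≢-nonZero p≢0

recip : ∀ {p} → p ≢ 0ℚ → ∃[ q ] p * q ≡ 1ℚ
recip {p} p≢0 = (1/ p) {{≢-nonZero p≢0}} , *-inverseʳ p {{≢-nonZero p≢0}}

recip⁺ : ∀ {p} → 0ℚ < p → ∃[ q ] 0ℚ < q × p * q ≡ 1ℚ
recip⁺ {p} 0<p =
  let instance p⁺ = positive 0<p; p≢0 = pos⇒nonZero p
  in 1/ p , positive⁻¹ (1/ p) {{1/pos⇒pos p}} , *-inverseʳ p

p-q≡0⇒p≡q : ∀ {p q} → p - q ≡ 0ℚ → p ≡ q
p-q≡0⇒p≡q {p} {q} h = begin
  p           ≡⟨ split p q ⟩
  p - q + q   ≡⟨ cong (_+ q) h ⟩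
  0ℚ + q      ≡⟨ +-identityˡ q ⟩
  q           ∎
  where
  open ≡-Reasoning
  split : ∀ p q → p ≡ p - q + q
  split = solve-∀ ℚ-ring

-- Finite sums and dot products

-- Opaque, so that the summand and the size can be inferred from a sum.
opaque
  ∑ : (Fin k → ℚ) → ℚ
  ∑ {k} = Σℚ k

  ∑≡Σℚ : (f : Fin k → ℚ) → ∑ f ≡ Σℚ k f
  ∑≡Σℚ f = refl

  ∑-suc : (f : Fin (suc k) → ℚ) → ∑ f ≡ f zero + ∑ (f ∘ suc)
  ∑-suc f = refl

  ∑-cong : {f g : Fin k → ℚ} → (∀ i → f i ≡ g i) → ∑ f ≡ ∑ g
  ∑-cong {zero}  f≗g = refl
  ∑-cong {suc k} f≗g = cong₂ _+_ (f≗g zero) (∑-cong (f≗g ∘ suc))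

  ∑-zero : {f : Fin k → ℚ} → (∀ i → f i ≡ 0ℚ) → ∑ f ≡ 0ℚ
  ∑-zero {zero}  f≗0 = refl
  ∑-zero {suc k} f≗0 = cong₂ _+_ (f≗0 zero) (∑-zero (f≗0 ∘ suc))

  ∑-distrib-+ : (f g : Fin k → ℚ) → ∑ (λ i → f i + g i) ≡ ∑ f + ∑ g
  ∑-distrib-+ {zero}  f g = refl
  ∑-distrib-+ {suc k} f g =
    trans (cong (f zero + g zero +_) (∑-distrib-+ (f ∘ suc) (g ∘ suc)))
          (interchange (f zero) (g zero) (∑ (f ∘ suc)) (∑ (g ∘ suc)))
    where
    interchange : ∀ a b c d → a + b + (c + d) ≡ a + c + (b + d)
    interchange = solve-∀ ℚ-ring

  *-distribˡ-∑ : ∀ t (f : Fin k → ℚ) → t * ∑ f ≡ ∑ (λ i → t * f i)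
  *-distribˡ-∑ {zero}  t f = *-zeroʳ t
  *-distribˡ-∑ {suc k} t f =
    trans (*-distribˡ-+ t (f zero) _) (cong (t * f zero +_) (*-distribˡ-∑ t (f ∘ suc)))

  ∑-mono : {f g : Fin k → ℚ} → (∀ i → f i ≤ g i) → ∑ f ≤ ∑ g
  ∑-mono {zero}  f≤g = ≤-refl
  ∑-mono {suc k} f≤g = +-mono-≤ (f≤g zero) (∑-mono (f≤g ∘ suc))

  ∑-nonneg : {f : Fin k → ℚ} → (∀ i → 0ℚ ≤ f i) → 0ℚ ≤ ∑ f
  ∑-nonneg {zero}  0≤f = ≤-refl
  ∑-nonneg {suc k} 0≤f = 0≤+0≤ (0≤f zero) (∑-nonneg (0≤f ∘ suc))

  term≤∑ : {f : Fin k → ℚ} → (∀ i → 0ℚ ≤ f i) → ∀ i → f i ≤ ∑ f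
  term≤∑ {suc k} {f} 0≤f zero =
    subst (_≤ ∑ f) (+-identityʳ (f zero)) (+-monoʳ-≤ (f zero) (∑-nonneg (0≤f ∘ suc)))
  term≤∑ {suc k} {f} 0≤f (suc i) =
    subst (_≤ ∑ f) (+-identityˡ (f (suc i))) (+-mono-≤ (0≤f zero) (term≤∑ (0≤f ∘ suc) i))

  ∑-swap : (f : Fin m → Fin k → ℚ) → ∑ (λ i → ∑ (f i)) ≡ ∑ (λ j → ∑ (λ i → f i j))
  ∑-swap {zero}  {k} f = sym (∑-zero {k} (λ _ → refl))
  ∑-swap {suc m} {k} f =
    trans (cong (∑ (f zero) +_) (∑-swap (f ∘ suc))) (sym (∑-distrib-+ (f zero) _))

infix 8 _·_

_·_ : (Fin k → ℚ) → (Fin k → ℚ) → ℚ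
a · x = ∑ (λ i → a i * x i)

·-comm : (a x : Fin k → ℚ) → a · x ≡ x · a
·-comm a x = ∑-cong (λ i → *-comm (a i) (x i))

·-axpy : (a x y : Fin k → ℚ) (t : ℚ) → a · (λ i → x i + t * y i) ≡ a · x + t * a · y
·-axpy a x y t = begin
  ∑ (λ i → a i * (x i + t * y i))             ≡⟨ ∑-cong (λ i → expand (a i) (x i) t (y i)) ⟩
  ∑ (λ i → a i * x i + t * (a i * y i))       ≡⟨ ∑-distrib-+ _ _ ⟩
  a · x + ∑ (λ i → t * (a i * y i))           ≡⟨ cong (a · x +_) (*-distribˡ-∑ t _) ⟨
  a · x + t * a · y                           ∎
  where
  open ≡-Reasoning
  expand : ∀ a x t y → a * (x + t * y) ≡ a * x + t * (a * y)
  expand = solve-∀ ℚ-ring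

·-scale : (a x : Fin k → ℚ) (t : ℚ) → a · (λ i → t * x i) ≡ t * a · x
·-scale a x t = trans (∑-cong (λ i → swap (a i) t (x i))) (sym (*-distribˡ-∑ t _))
  where
  swap : ∀ a t x → a * (t * x) ≡ t * (a * x)
  swap = solve-∀ ℚ-ring

·-zeroʳ : (a : Fin k → ℚ) → a · (λ _ → 0ℚ) ≡ 0ℚ
·-zeroʳ a = ∑-zero (λ i → *-zeroʳ (a i))

·-assoc : (y : Fin m → ℚ) (N : Fin m → Fin k → ℚ) (x : Fin k → ℚ) →
          y · (λ i → N i · x) ≡ (λ j → y · flip N j) · x
·-assoc y N x = begin
  ∑ (λ i → y i * N i · x)                     ≡⟨ ∑-cong (λ i → *-distribˡ-∑ (y i) _) ⟩
  ∑ (λ i → ∑ (λ j → y i * (N i j * x j)))     ≡⟨ ∑-swap _ ⟩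
  ∑ (λ j → ∑ (λ i → y i * (N i j * x j)))     ≡⟨ ∑-cong (λ j → ∑-cong (λ i → rotate (y i) (N i j) (x j))) ⟩
  ∑ (λ j → ∑ (λ i → x j * (y i * N i j)))     ≡⟨ ∑-cong (λ j → *-distribˡ-∑ (x j) _) ⟨
  ∑ (λ j → x j * y · flip N j)                ≡⟨ ∑-cong (λ j → *-comm (x j) _) ⟩
  ∑ (λ j → y · flip N j * x j)                ∎
  where
  open ≡-Reasoning
  rotate : ∀ y n x → y * (n * x) ≡ x * (y * n)
  rotate = solve-∀ ℚ-ring

unit : Fin k → Fin k → ℚ
unit zero    zero    = 1ℚ
unit zero    (suc j) = 0ℚ
unit (suc i) zero    = 0ℚ
unit (suc i) (suc j) = unit i j

unit-diag : (i : Fin k) → unit i i ≡ 1ℚ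
unit-diag zero    = refl
unit-diag (suc i) = unit-diag i

unit-off : (i j : Fin k) → i ≢ j → unit i j ≡ 0ℚ
unit-off zero    zero    i≢j = ⊥-elim (i≢j refl)
unit-off zero    (suc j) i≢j = refl
unit-off (suc i) zero    i≢j = refl
unit-off (suc i) (suc j) i≢j = unit-off i j (i≢j ∘ cong suc)

0≤unit : (i j : Fin k) → 0ℚ ≤ unit i j
0≤unit zero    zero    = nonNegative⁻¹ 1ℚ
0≤unit zero    (suc j) = ≤-refl
0≤unit (suc i) zero    = ≤-refl
0≤unit (suc i) (suc j) = 0≤unit i j

·-unitʳ : (a : Fin k → ℚ) (i : Fin k) → a · unit i ≡ a i
·-unitʳ a zero    = trans (∑-suc _) (trans (cong₂ _+_ (*-identityʳ (a zero)) (·-zeroʳ (a ∘ suc))) (+-identityʳ (a zero)))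
·-unitʳ a (suc i) = trans (∑-suc _) (trans (cong₂ _+_ (*-zeroʳ (a zero)) (·-unitʳ (a ∘ suc) i)) (+-identityˡ (a (suc i))))

·-unitˡ : (i : Fin k) (a : Fin k → ℚ) → unit i · a ≡ a i
·-unitˡ i a = trans (·-comm (unit i) a) (·-unitʳ a i)

-- Fourier–Motzkin elimination

-- (a , p , q) is the affine form p + q t - a·x in the variables x and a parameter t.
Form : ℕ → Set
Form n = (Fin n → ℚ) × ℚ × ℚ

eval : ℚ → (Fin n → ℚ) → Form n → ℚ
eval t x (a , p , q) = p + q * t - a · x

Nonneg : ℚ → (Fin n → ℚ) → List (Form n) → Set
Nonneg t x = All (λ F → 0ℚ ≤ eval t x F)

infixr 5 _∷ᶠ_

_∷ᶠ_ : ℚ → (Fin n → ℚ) → Fin (suc n) → ℚ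
(s ∷ᶠ x) zero    = s
(s ∷ᶠ x) (suc i) = x i

·-cons : (a x : Fin (suc n) → ℚ) → a · x ≡ a zero * x zero + (a ∘ suc) · (x ∘ suc)
·-cons a x = ∑-suc _

scale : ℚ → Form n → Form n
scale s (a , p , q) = (λ i → s * a i) , s * p , s * q

-- The coefficients are written as `a i + - 1ℚ * a′ i` so that `·-axpy` applies to them.
_⊖_ : Form n → Form n → Form n
(a , p , q) ⊖ (a′ , p′ , q′) = (λ i → a i + - 1ℚ * a′ i) , p - p′ , q - q′

tailᶠ : Form (suc n) → Form n
tailᶠ (a , p , q) = a ∘ suc , p , q

eval-scale : ∀ t (x : Fin n → ℚ) s F → eval t x (scale s F) ≡ s * eval t x F
eval-scale t x s (a , p , q) =
  trans (cong (λ d → s * p + s * q * t - d) (trans (·-comm _ x) (trans (·-scale x a s) (cong (s *_) (·-comm x a)))))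
        (factor s p q t (a · x))
  where
  factor : ∀ s p q t d → s * p + s * q * t - s * d ≡ s * (p + q * t - d)
  factor = solve-∀ ℚ-ring

eval-⊖ : ∀ t (x : Fin n → ℚ) F G → eval t x (F ⊖ G) ≡ eval t x F - eval t x G
eval-⊖ t x (a , p , q) (a′ , p′ , q′) =
  trans (cong (λ d → p - p′ + (q - q′) * t - d)
              (trans (·-comm _ x) (trans (·-axpy x a a′ (- 1ℚ)) (cong₂ (λ u v → u + - 1ℚ * v) (·-comm x a) (·-comm x a′)))))
        (regroup p p′ q q′ t (a · x) (a′ · x))
  where
  regroup : ∀ p p′ q q′ t d d′ →
            p - p′ + (q - q′) * t - (d + - 1ℚ * d′) ≡ p + q * t - d - (p′ + q′ * t - d′)
  regroup = solve-∀ ℚ-ring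

eval-tail : ∀ t (x : Fin (suc n) → ℚ) F →
            eval t x F ≡ eval t (x ∘ suc) (tailᶠ F) - proj₁ F zero * x zero
eval-tail t x (a , p , q) =
  trans (cong (λ d → p + q * t - d) (·-cons a x)) (regroup p q t (a zero) (x zero) _)
  where
  regroup : ∀ p q t a₀ x₀ d → p + q * t - (a₀ * x₀ + d) ≡ p + q * t - d - a₀ * x₀
  regroup = solve-∀ ℚ-ring

record Bounds (n : ℕ) : Set where
  constructor bounds
  field
    lower upper rest : List (Form n)

Within : ℚ → (Fin n → ℚ) → ℚ → Bounds n → Set
Within t x s (bounds lo up re) =
  All (λ F → eval t x F ≤ s) lo × All (λ F → s ≤ eval t x F) up × Nonneg t x re

-- A constraint `0 ≤ e - a * s` is divided by the absolute value of `a`: positive `a` gives an upper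
-- bound on the head variable `s`, negative `a` a lower bound, and `a = 0` leaves a constraint on
-- the other variables.
solveHead : (S : List (Form (suc n))) →
  ∃[ B ] ∀ t x → (Nonneg t x S → Within t (x ∘ suc) (x zero) B) × (Within t (x ∘ suc) (x zero) B → Nonneg t x S)
solveHead [] = bounds [] [] [] , λ t x → (λ _ → [] , [] , []) , (λ _ → [])
solveHead (F ∷ S) with solveHead S | <-cmp (proj₁ F zero) 0ℚ
... | bounds lo up re , ih | tri≈ _ a≡0 _ = bounds lo up (tailᶠ F ∷ re) , λ t x →
    (λ { (h ∷ hs) → let (l , u , r) = proj₁ (ih t x) hs in l , u , subst (0ℚ ≤_) (eq t x) h ∷ r })
  , (λ { (l , u , h ∷ r) → subst (0ℚ ≤_) (sym (eq t x)) h ∷ proj₂ (ih t x) (l , u , r) })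
  where
  kill : ∀ e s → e - 0ℚ * s ≡ e
  kill = solve-∀ ℚ-ring
  eq : ∀ t x → eval t x F ≡ eval t (x ∘ suc) (tailᶠ F)
  eq t x = trans (eval-tail t x F) (trans (cong (λ a → eval t (x ∘ suc) (tailᶠ F) - a * x zero) a≡0) (kill _ (x zero)))
... | bounds lo up re , ih | tri> _ _ 0<a = bounds lo (scale s (tailᶠ F) ∷ up) re , λ t x →
    (λ { (h ∷ hs) → let (l , u , r) = proj₁ (ih t x) hs in l , 0≤-⇒≤ (subst (0ℚ ≤_) (eq t x) (0≤*0≤ (<⇒≤ 0<s) h)) ∷ u , r })
  , (λ { (l , h ∷ u , r) →
         subst (0ℚ ≤_) (unscale t x) (0≤*0≤ (<⇒≤ 0<a) (subst (0ℚ ≤_) (sym (eq t x)) (≤⇒0≤- h)))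
         ∷ proj₂ (ih t x) (l , u , r) })
  where
  a₀ = proj₁ F zero
  s = proj₁ (recip⁺ 0<a)
  0<s = proj₁ (proj₂ (recip⁺ 0<a))
  as≡1 : a₀ * s ≡ 1ℚ
  as≡1 = proj₂ (proj₂ (recip⁺ 0<a))
  expand : ∀ s e a x → s * (e - a * x) ≡ s * e - a * s * x
  expand = solve-∀ ℚ-ring
  eq : ∀ t x → s * eval t x F ≡ eval t (x ∘ suc) (scale s (tailᶠ F)) - x zero
  eq t x = trans (cong (s *_) (eval-tail t x F)) (trans (expand s _ a₀ (x zero))
    (cong₂ _-_ (sym (eval-scale t (x ∘ suc) s (tailᶠ F))) (trans (cong (_* x zero) as≡1) (*-identityˡ (x zero)))))
  unscale : ∀ t x → a₀ * (s * eval t x F) ≡ eval t x F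
  unscale t x = trans (sym (*-assoc a₀ s _)) (trans (cong (_* eval t x F) as≡1) (*-identityˡ _))
... | bounds lo up re , ih | tri< a<0 _ _ = bounds (scale (- s) (tailᶠ F) ∷ lo) up re , λ t x →
    (λ { (h ∷ hs) → let (l , u , r) = proj₁ (ih t x) hs in 0≤-⇒≤ (subst (0ℚ ≤_) (eq t x) (0≤*0≤ (<⇒≤ 0<s) h)) ∷ l , u , r })
  , (λ { (h ∷ l , u , r) →
         subst (0ℚ ≤_) (unscale t x) (0≤*0≤ (<⇒≤ 0<-a) (subst (0ℚ ≤_) (sym (eq t x)) (≤⇒0≤- h)))
         ∷ proj₂ (ih t x) (l , u , r) })
  where
  a₀ = proj₁ F zero
  0<-a : 0ℚ < - a₀
  0<-a = neg-antimono-< a<0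
  s = proj₁ (recip⁺ 0<-a)
  0<s = proj₁ (proj₂ (recip⁺ 0<-a))
  as≡1 : - a₀ * s ≡ 1ℚ
  as≡1 = proj₂ (proj₂ (recip⁺ 0<-a))
  expand : ∀ s e a x → s * (e - a * x) ≡ (- a * s) * x - (- s) * e
  expand = solve-∀ ℚ-ring
  eq : ∀ t x → s * eval t x F ≡ x zero - eval t (x ∘ suc) (scale (- s) (tailᶠ F))
  eq t x = trans (cong (s *_) (eval-tail t x F)) (trans (expand s _ a₀ (x zero))
    (cong₂ _-_ (trans (cong (_* x zero) as≡1) (*-identityˡ (x zero))) (sym (eval-scale t (x ∘ suc) (- s) (tailᶠ F)))))
  unscale : ∀ t x → - a₀ * (s * eval t x F) ≡ eval t x F
  unscale t x = trans (sym (*-assoc (- a₀) s _)) (trans (cong (_* eval t x F) as≡1) (*-identityˡ _))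

lowerBound : ∀ {A : Set} (f : A → ℚ) (ups : List A) → ∃[ s ] All (λ u → s ≤ f u) ups
-- With no upper bounds any value serves; zero is an arbitrary choice.
lowerBound f [] = 0ℚ , []
lowerBound f (u ∷ ups) =
  let (s , hs) = lowerBound f ups
  in f u ⊓ s , p⊓q≤p (f u) s ∷ All.map (≤-trans (p⊓q≤q (f u) s)) hs

-- Start below all upper bounds and take the maximum with each lower bound in turn; each such
-- maximum stays below every upper bound by assumption.
between : ∀ {A : Set} (f : A → ℚ) (los ups : List A) →
          All (λ l → All (λ u → f l ≤ f u) ups) los →
          ∃[ s ] All (λ l → f l ≤ s) los × All (λ u → s ≤ f u) ups
between f [] ups _ = let (s , hs) = lowerBound f ups in s , [] , hs
between f (l ∷ los) ups (h ∷ hs) =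
  let (s , ls , us) = between f los ups hs
  in f l ⊔ s , p≤p⊔q (f l) s ∷ All.map (λ l≤s → ≤-trans l≤s (p≤q⊔p (f l) s)) ls
   , All.zipWith (λ (l≤u , s≤u) → ⊔-lub l≤u s≤u) (h , us)

differences : List (Form n) → List (Form n) → List (Form n)
differences []        ups = []
differences (l ∷ los) ups = map (_⊖ l) ups ++ differences los ups

differences⁺ : ∀ t (x : Fin n → ℚ) los ups →
  All (λ l → All (λ u → eval t x l ≤ eval t x u) ups) los → Nonneg t x (differences los ups)
differences⁺ t x [] ups [] = []
differences⁺ t x (l ∷ los) ups (h ∷ hs) = All.++⁺
  (All.map⁺ (All.map (λ {u} l≤u → subst (0ℚ ≤_) (sym (eval-⊖ t x u l)) (≤⇒0≤- l≤u)) h))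
  (differences⁺ t x los ups hs)

differences⁻ : ∀ t (x : Fin n → ℚ) los ups → Nonneg t x (differences los ups) →
  All (λ l → All (λ u → eval t x l ≤ eval t x u) ups) los
differences⁻ t x [] ups _ = []
differences⁻ t x (l ∷ los) ups h =
  All.map (λ {u} h → 0≤-⇒≤ (subst (0ℚ ≤_) (eval-⊖ t x u l) h)) (All.map⁻ (All.++⁻ˡ (map (_⊖ l) ups) h))
  ∷ differences⁻ t x los ups (All.++⁻ʳ (map (_⊖ l) ups) h)

eliminate : (S : List (Form (suc n))) →
  ∃[ S′ ] (∀ t x → Nonneg t x S → Nonneg t (x ∘ suc) S′) ×
          (∀ t x → Nonneg t x S′ → ∃[ s ] Nonneg t (s ∷ᶠ x) S)
eliminate S with solveHead S
... | bounds lo up re , ih = differences lo up ++ re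
  , (λ t x h → let (l , u , r) = proj₁ (ih t x) h in
       All.++⁺ (differences⁺ t (x ∘ suc) lo up (All.map (λ l≤s → All.map (≤-trans l≤s) u) l)) r)
  , (λ t x h →
       let (s , ls , us) = between (eval t x) lo up (differences⁻ t x lo up (All.++⁻ˡ (differences lo up) h))
       in s , proj₂ (ih t (s ∷ᶠ x)) (ls , us , All.++⁻ʳ (differences lo up) h))

grow : ∀ p {q t t′} → 0ℚ ≤ q → t ≤ t′ → 0ℚ ≤ p + q * t → 0ℚ ≤ p + q * t′
grow p 0≤q t≤t′ h = ≤-trans h (+-monoʳ-≤ p (*-monoˡ 0≤q t≤t′))

Nonneg₀ : ℚ → List (ℚ × ℚ) → Set
Nonneg₀ t = All (λ (p , q) → 0ℚ ≤ p + q * t)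

-- A constraint of nonnegative slope that holds at `t₀` holds from there on, and one of negative
-- slope is an upper bound on `t`. So either the least of these bounds is the maximum, or the whole
-- ray above `t₀` is feasible.
maximise₀ : (S : List (ℚ × ℚ)) (t₀ : ℚ) → Nonneg₀ t₀ S →
  (∃[ t* ] t₀ ≤ t* × Nonneg₀ t* S × (∀ t → Nonneg₀ t S → t ≤ t*)) ⊎ (∀ t → t₀ ≤ t → Nonneg₀ t S)
maximise₀ [] t₀ [] = inj₂ (λ _ _ → [])
maximise₀ ((p , q) ∷ S) t₀ (h ∷ hs) with maximise₀ S t₀ hs | 0ℚ ≤? q
... | inj₂ all | yes 0≤q = inj₂ (λ t t₀≤t → grow p 0≤q t₀≤t h ∷ all t t₀≤t)
... | inj₁ (t* , t₀≤t* , ok , max) | yes 0≤q =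
      inj₁ (t* , t₀≤t* , grow p 0≤q t₀≤t* h ∷ ok , λ { t (_ ∷ ht) → max t ht })
... | r | no 0≰q = inj₁ (finish r)
  where
  0<-q : 0ℚ < - q
  0<-q = neg-antimono-< (≰⇒> 0≰q)
  u = proj₁ (recip⁺ 0<-q)
  0<u = proj₁ (proj₂ (recip⁺ 0<-q))
  qu≡1 : - q * u ≡ 1ℚ
  qu≡1 = proj₂ (proj₂ (recip⁺ 0<-q))
  expand : ∀ p q u t → u * (p + q * t) ≡ p * u - (- q * u) * t
  expand = solve-∀ ℚ-ring
  eq : ∀ t → u * (p + q * t) ≡ p * u - t
  eq t = trans (expand p q u t) (cong (λ d → p * u - d) (trans (cong (_* t) qu≡1) (*-identityˡ t)))
  bound⁺ : ∀ t → 0ℚ ≤ p + q * t → t ≤ p * u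
  bound⁺ t h = 0≤-⇒≤ (subst (0ℚ ≤_) (eq t) (0≤*0≤ (<⇒≤ 0<u) h))
  bound⁻ : ∀ t → t ≤ p * u → 0ℚ ≤ p + q * t
  bound⁻ t h = *-cancelˡ-≤-pos u {{positive 0<u}}
    (subst₂ _≤_ (sym (*-zeroʳ u)) (sym (eq t)) (≤⇒0≤- h))
  t₀≤ = bound⁺ t₀ h
  finish : _ → ∃[ t* ] t₀ ≤ t* × Nonneg₀ t* ((p , q) ∷ S) × (∀ t → Nonneg₀ t ((p , q) ∷ S) → t ≤ t*)
  finish (inj₂ all) =
    p * u , t₀≤ , bound⁻ (p * u) ≤-refl ∷ all (p * u) t₀≤ , λ { t (ht ∷ _) → bound⁺ t ht }
  finish (inj₁ (t* , t₀≤t* , ok , max)) with ≤-total t* (p * u)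
  ... | inj₁ t*≤ = t* , t₀≤t* , bound⁻ t* t*≤ ∷ ok , λ { t (_ ∷ ht) → max t ht }
  ... | inj₂ ≤t* = p * u , t₀≤ , bound⁻ (p * u) ≤-refl ∷ shrink ok hs , λ { t (ht ∷ _) → bound⁺ t ht }
    where
    -- Each constraint holds at both ends of [t₀ , t*], hence in between.
    shrink : ∀ {S} → Nonneg₀ t* S → Nonneg₀ t₀ S → Nonneg₀ (p * u) S
    shrink [] [] = []
    shrink {(p′ , q′) ∷ _} (k ∷ ks) (h ∷ hs) with 0ℚ ≤? q′
    ... | yes 0≤q′ = grow p′ 0≤q′ t₀≤ h ∷ shrink ks hs
    ... | no 0≰q′ = ≤-trans k (+-monoʳ-≤ p′ (*-monoˡ-≤-nonPos q′ {{nonPositive (<⇒≤ (≰⇒> 0≰q′))}} ≤t*)) ∷ shrink ks hs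

maximise : (S : List (Form n)) (t₀ B : ℚ) (x₀ : Fin n → ℚ) → Nonneg t₀ x₀ S →
  (∀ t x → Nonneg t x S → t ≤ B) →
  ∃[ t* ] ∃[ x* ] Nonneg t* x* S × (∀ t x → Nonneg t x S → t ≤ t*)
maximise {zero} S t₀ B x₀ h₀ bnd = finish (maximise₀ (map proj₂ S) t₀ (to t₀ x₀ h₀))
  where
  closed : ∀ t (x : Fin 0 → ℚ) F → eval t x F ≡ proj₁ (proj₂ F) + proj₂ (proj₂ F) * t
  closed t x (a , p , q) = trans (cong (λ d → p + q * t - d) (∑≡Σℚ _)) (+-identityʳ _)
  to : ∀ t x → Nonneg t x S → Nonneg₀ t (map proj₂ S)
  to t x h = All.map⁺ (All.map (λ {F} → subst (0ℚ ≤_) (closed t x F)) h)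
  from : ∀ t x → Nonneg₀ t (map proj₂ S) → Nonneg t x S
  from t x h = All.map (λ {F} → subst (0ℚ ≤_) (sym (closed t x F))) (All.map⁻ h)
  finish : _ → _
  finish (inj₁ (t* , _ , ok , max)) = t* , x₀ , from t* x₀ ok , λ t x h → max t (to t x h)
  -- `bnd` places `B` above `t₀`, so on this branch `B` is itself feasible; being an upper bound, it
  -- is the maximum.
  finish (inj₂ all) = B , x₀ , from B x₀ (all B (bnd t₀ x₀ h₀)) , bnd
maximise {suc n} S t₀ B x₀ h₀ bnd =
  let (S′ , fwd , bwd) = eliminate S
      (t* , x* , ok , max) = maximise S′ t₀ B (x₀ ∘ suc) (fwd t₀ x₀ h₀)
                               (λ t x h → bnd t _ (proj₂ (bwd t x h)))
      (s , h) = bwd t* x* ok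
  in t* , s ∷ᶠ x* , h , λ t x h → max t (x ∘ suc) (fwd t x h)

-- Linear algebra on the block of a matrix with rows T and columns σ

≡true∧≡false : ∀ {x : Bool} {A : Set} → x ≡ true → x ≡ false → A
≡true∧≡false refl ()

Supp : Subset k → (Fin k → ℚ) → Set
Supp σ x = ∀ j → lookup σ j ≡ false → x j ≡ 0ℚ

·-cong-on : ∀ (T : Subset k) {y a b} → Supp T y → (∀ i → lookup T i ≡ true → a i ≡ b i) → y · a ≡ y · b
·-cong-on T {y} {a} {b} supp a≗b = ∑-cong term
  where
  term : ∀ i → y i * a i ≡ y i * b i
  term i with lookup T i in eq
  ... | true  = cong (y i *_) (a≗b i eq)
  ... | false rewrite supp i eq = trans (*-zeroˡ (a i)) (sym (*-zeroˡ (b i)))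

tail-· : (a x : Fin (suc k) → ℚ) → x zero ≡ 0ℚ → (a ∘ suc) · (x ∘ suc) ≡ a · x
tail-· a x x₀≡0 = sym (trans (·-cons a x)
  (trans (cong (_+ (a ∘ suc) · (x ∘ suc)) (trans (cong (a zero *_) x₀≡0) (*-zeroʳ (a zero)))) (+-identityˡ _)))

Solution : Subset m → Subset k → (Fin m → Fin k → ℚ) → (Fin m → ℚ) → Set
Solution T σ M d = ∃[ x ] Supp σ x × (∀ i → lookup T i ≡ true → M i · x ≡ d i)

Obstruction : Subset m → Subset k → (Fin m → Fin k → ℚ) → (Fin m → ℚ) → Set
Obstruction T σ M d = ∃[ y ] Supp T y × (∀ j → lookup σ j ≡ true → y · flip M j ≡ 0ℚ) × y · d ≢ 0ℚ

-- Induction on the columns. A head column in the span of the other selected ones adds nothing;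
-- otherwise some `z` annihilates those but not the head column, and so dictates its coefficient in
-- any solution.
fredholm : (T : Subset m) (σ : Subset k) (M : Fin m → Fin k → ℚ) (d : Fin m → ℚ) →
           Solution T σ M d ⊎ Obstruction T σ M d
fredholm {k = zero} T [] M d with Fin.all? (λ i → (lookup T i Bool.≟ true) →-dec (0ℚ ≟ d i))
... | yes all = inj₁ ((λ ()) , (λ ()) , λ i i∈T → trans (∑-zero (λ ())) (all i i∈T))
... | no ¬all with Fin.¬∀⟶∃¬ _ _ (λ i → (lookup T i Bool.≟ true) →-dec (0ℚ ≟ d i)) ¬all
...   | i , ¬h = inj₂ (unit i , supp , (λ ()) , λ eq → ¬h (λ _ → sym (trans (sym (·-unitˡ i d)) eq)))
  where
  i∈T : lookup T i ≡ true
  i∈T = decidable-stable (lookup T i Bool.≟ true) (λ i∉T → ¬h (⊥-elim ∘ i∉T))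
  supp : Supp T (unit i)
  supp j j∉T = unit-off i j λ { refl → ≡true∧≡false i∈T j∉T }
fredholm {k = suc k} T (false ∷ σ) M d with fredholm T σ (λ i → M i ∘ suc) d
... | inj₁ (x , supp , sol) = inj₁ (0ℚ ∷ᶠ x
      , (λ { zero _ → refl ; (suc j) → supp j })
      , λ i i∈T → trans (·-cons (M i) _) (trans (cong₂ _+_ (*-zeroʳ (M i zero)) (sol i i∈T)) (+-identityˡ (d i))))
... | inj₂ (y , supp , perp , ≢0) = inj₂ (y , supp , (λ { (suc j) → perp j }) , ≢0)
fredholm {k = suc k} T (true ∷ σ) M d with fredholm T σ (λ i → M i ∘ suc) (λ i → M i zero)
... | inj₁ (x′ , supp′ , sol′) = [ inj₁ ∘ extend , inj₂ ∘ perp-extend ]′ (fredholm T σ (λ i → M i ∘ suc) d)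
  where
  extend : Solution T σ (λ i → M i ∘ suc) d → Solution T (true ∷ σ) M d
  extend (x , supp , sol) = 0ℚ ∷ᶠ x , (λ { (suc j) → supp j })
    , λ i i∈T → trans (·-cons (M i) _) (trans (cong₂ _+_ (*-zeroʳ (M i zero)) (sol i i∈T)) (+-identityˡ (d i)))
  perp-extend : Obstruction T σ (λ i → M i ∘ suc) d → Obstruction T (true ∷ σ) M d
  perp-extend (y , supp , perp , ≢0) = y , supp , (λ { zero _ → perp₀ ; (suc j) → perp j }) , ≢0
    where
    open ≡-Reasoning
    -- `y` kills the other selected columns, hence also their combination, which on `T` is the head
    -- column.
    perp₀ : y · flip M zero ≡ 0ℚ
    perp₀ = begin
      y · (λ i → M i zero)                             ≡⟨ ·-cong-on T supp sol′ ⟨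
      y · (λ i → (M i ∘ suc) · x′)                     ≡⟨ ·-assoc y (λ i → M i ∘ suc) x′ ⟩
      (λ j → y · (λ i → M i (suc j))) · x′             ≡⟨ ·-comm _ x′ ⟩
      x′ · (λ j → y · (λ i → M i (suc j)))             ≡⟨ ·-cong-on σ supp′ perp ⟩
      x′ · (λ _ → 0ℚ)                                  ≡⟨ ·-zeroʳ x′ ⟩
      0ℚ                                               ∎
... | inj₂ (z , suppᶻ , perpᶻ , zc≢0) = [ inj₁ ∘ extend , inj₂ ∘ perp-extend ]′ (fredholm T σ (λ i → M i ∘ suc) d′)
  where
  -- Subtract the multiple s of the head column from d so that z no longer obstructs.
  col = λ i → M i zero
  u = proj₁ (recip zc≢0)
  cu≡1 : z · col * u ≡ 1ℚ
  cu≡1 = proj₂ (recip zc≢0)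
  s = z · d * u
  d′ = λ i → d i + - s * col i
  extend : Solution T σ (λ i → M i ∘ suc) d′ → Solution T (true ∷ σ) M d
  extend (x , supp , sol) = s ∷ᶠ x , (λ { (suc j) → supp j })
    , λ i i∈T → trans (·-cons (M i) _) (trans (cong (M i zero * s +_) (sol i i∈T)) (cancel (M i zero) s (d i)))
    where
    cancel : ∀ c s d → c * s + (d + - s * c) ≡ d
    cancel = solve-∀ ℚ-ring
  perp-extend : Obstruction T σ (λ i → M i ∘ suc) d′ → Obstruction T (true ∷ σ) M d
  perp-extend (y , supp , perp , ≢0) = y′ , supp′ , perp′ , λ eq → ≢0 (trans same eq)
    where
    open ≡-Reasoning
    -- Correcting `y` by a multiple of `z` makes it orthogonal to the head column too; `same` shows
    -- that this trades its value on `d′` for the equal value on `d`.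
    r = y · col * u
    y′ = λ i → y i + - r * z i
    dot : ∀ a → y′ · a ≡ y · a + - r * z · a
    dot a = trans (·-comm y′ a) (trans (·-axpy a y z (- r)) (cong₂ (λ p q → p + - r * q) (·-comm a y) (·-comm a z)))
    both-zero : ∀ {p q} r → p ≡ 0ℚ → q ≡ 0ℚ → p + - r * q ≡ 0ℚ
    both-zero r refl refl = trans (+-identityˡ _) (*-zeroʳ (- r))
    supp′ : Supp T y′
    supp′ i i∉T = both-zero r (supp i i∉T) (suppᶻ i i∉T)
    reassoc : ∀ a c u → a + - (a * u) * c ≡ a - a * (c * u)
    reassoc = solve-∀ ℚ-ring
    perp′ : ∀ j → lookup (true ∷ σ) j ≡ true → y′ · flip M j ≡ 0ℚ
    perp′ (suc j) j∈σ = trans (dot _) (both-zero r (perp j j∈σ) (perpᶻ j j∈σ))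
    perp′ zero _ = begin
      y′ · col                                 ≡⟨ dot col ⟩
      y · col + - (y · col * u) * z · col      ≡⟨ reassoc (y · col) (z · col) u ⟩
      y · col - y · col * (z · col * u)        ≡⟨ cong (λ e → y · col - y · col * e) cu≡1 ⟩
      y · col - y · col * 1ℚ                   ≡⟨ cong (λ e → y · col - e) (*-identityʳ (y · col)) ⟩
      y · col - y · col                        ≡⟨ +-inverseʳ (y · col) ⟩
      0ℚ                                       ∎
    exchange : ∀ a b c u → a + - (b * u) * c ≡ a + - (c * u) * b
    exchange = solve-∀ ℚ-ring
    same : y · d′ ≡ y′ · d
    same = begin
      y · d′                              ≡⟨ ·-axpy y d col (- s) ⟩
      y · d + - (z · d * u) * y · col     ≡⟨ exchange (y · d) (z · d) (y · col) u ⟩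
      y · d + - (y · col * u) * z · d     ≡⟨ dot d ⟨
      y′ · d                              ∎

InKernel : Subset m → Subset k → (Fin m → Fin k → ℚ) → (Fin k → ℚ) → Set
InKernel T σ M x = Supp σ x × (∀ i → lookup T i ≡ true → M i · x ≡ 0ℚ)

TrivialKernel : Subset m → Subset k → (Fin m → Fin k → ℚ) → Set
TrivialKernel T σ M = ∀ x → InKernel T σ M x → ∀ j → x j ≡ 0ℚ

-- If the later selected columns are independent, the head column either depends on them, which
-- yields a kernel vector with head entry `- 1ℚ`, or is separated from them by some `y`, which
-- forces the head entry of every kernel vector to vanish.
kernel? : (T : Subset m) (σ : Subset k) (M : Fin m → Fin k → ℚ) →
          (∃[ x ] InKernel T σ M x × ∃[ j ] x j ≢ 0ℚ) ⊎ TrivialKernel T σ M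
kernel? T [] M = inj₂ (λ _ _ ())
kernel? T (s ∷ σ) M with kernel? T σ (λ i → M i ∘ suc)
... | inj₁ (x , (supp , ker) , j , xj≢0) = inj₁ (0ℚ ∷ᶠ x
      , ((λ { zero _ → refl ; (suc j) → supp j })
        , λ i i∈T → trans (·-cons (M i) _) (cong₂ _+_ (*-zeroʳ (M i zero)) (ker i i∈T)))
      , suc j , xj≢0)
kernel? T (false ∷ σ) M | inj₂ triv = inj₂ λ x (supp , ker) → λ
  { zero → supp zero refl
  ; (suc j) → triv (x ∘ suc) ((supp ∘ suc) , λ i i∈T → trans (tail-· (M i) x (supp zero refl)) (ker i i∈T)) j }
kernel? T (true ∷ σ) M | inj₂ triv with fredholm T σ (λ i → M i ∘ suc) (λ i → M i zero)
... | inj₁ (x , supp , sol) = inj₁ ((- 1ℚ) ∷ᶠ x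
      , ((λ { (suc j) → supp j })
        , λ i i∈T → trans (·-cons (M i) _) (trans (cong (M i zero * - 1ℚ +_) (sol i i∈T)) (cancel (M i zero))))
      , zero , λ ())
  where
  cancel : ∀ c → c * - 1ℚ + c ≡ 0ℚ
  cancel = solve-∀ ℚ-ring
... | inj₂ (y , supp , perp , yc≢0) = inj₂ λ x xker → λ
  { zero → head-zero x xker
  ; (suc j) → triv (x ∘ suc) ((proj₁ xker ∘ suc) , λ i i∈T → trans (tail-· (M i) x (head-zero x xker)) (proj₂ xker i i∈T)) j }
  where
  head-zero : ∀ x → InKernel T (true ∷ σ) M x → x zero ≡ 0ℚ
  head-zero x (suppˣ , ker) = decidable-stable (x zero ≟ 0ℚ) λ x₀≢0 → *-≢0 yc≢0 x₀≢0 (begin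
    y · flip M zero * x zero
      ≡⟨ +-identityʳ _ ⟨
    y · flip M zero * x zero + 0ℚ
      ≡⟨ cong (y · flip M zero * x zero +_) rest ⟨
    y · flip M zero * x zero + (λ j → y · flip M (suc j)) · (x ∘ suc)
      ≡⟨ ·-cons (λ j → y · flip M j) x ⟨
    (λ j → y · flip M j) · x
      ≡⟨ ·-assoc y M x ⟨
    y · (λ i → M i · x)
      ≡⟨ ·-cong-on T supp ker ⟩
    y · (λ _ → 0ℚ)
      ≡⟨ ·-zeroʳ y ⟩
    0ℚ ∎)
    where
    open ≡-Reasoning
    rest : (λ j → y · flip M (suc j)) · (x ∘ suc) ≡ 0ℚ
    rest = trans (·-comm _ (x ∘ suc)) (trans (·-cong-on σ (suppˣ ∘ suc) perp) (·-zeroʳ (x ∘ suc)))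

-- Small steps and generic vectors

-- For negative `d` the threshold is the root `s / (- d)`, which is positive because the second
-- hypothesis excludes `s ≡ 0ℚ`.
small-step : ∀ {s d} → 0ℚ ≤ s → (s ≡ 0ℚ → 0ℚ ≤ d) → ∃[ δ ] 0ℚ < δ × (∀ ε → 0ℚ ≤ ε → ε ≤ δ → 0ℚ ≤ s + ε * d)
small-step {s} {d} 0≤s tight with 0ℚ ≤? d | s ≟ 0ℚ
... | yes 0≤d | _ = 1ℚ , positive⁻¹ 1ℚ , λ ε 0≤ε _ → 0≤+0≤ 0≤s (0≤*0≤ 0≤ε 0≤d)
... | no 0≰d | yes s≡0 = ⊥-elim (0≰d (tight s≡0))
... | no 0≰d | no s≢0 = s * u , 0<*0< 0<s 0<u , λ ε 0≤ε ε≤ →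
      subst (0ℚ ≤_) (regroup s ε d) (≤⇒0≤- (≤-trans (*-monoʳ (<⇒≤ 0<-d) ε≤)
        (≤-reflexive (trans (*-assoc s u (- d)) (trans (cong (s *_) (trans (*-comm u (- d)) du≡1)) (*-identityʳ s))))))
  where
  0<s : 0ℚ < s
  0<s = ≤∧≢⇒< 0≤s (s≢0 ∘ sym)
    where
    ≤∧≢⇒< : ∀ {p q} → p ≤ q → p ≢ q → p < q
    ≤∧≢⇒< {p} {q} p≤q p≢q = ≰⇒> (λ q≤p → p≢q (≤-antisym p≤q q≤p))
  0<-d : 0ℚ < - d
  0<-d = neg-antimono-< (≰⇒> 0≰d)
  u = proj₁ (recip⁺ 0<-d)
  0<u = proj₁ (proj₂ (recip⁺ 0<-d))
  du≡1 : - d * u ≡ 1ℚ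
  du≡1 = proj₂ (proj₂ (recip⁺ 0<-d))
  regroup : ∀ s ε d → s - ε * - d ≡ s + ε * d
  regroup = solve-∀ ℚ-ring

⊓-pos : ∀ {p q} → 0ℚ < p → 0ℚ < q → 0ℚ < p ⊓ q
⊓-pos {p} {q} 0<p 0<q with ≤-total p q
... | inj₁ p≤q = subst (0ℚ <_) (sym (p≤q⇒p⊓q≡p p≤q)) 0<p
... | inj₂ q≤p = subst (0ℚ <_) (sym (p≥q⇒p⊓q≡q q≤p)) 0<q

small-steps : {s d : Fin k → ℚ} → (∀ i → 0ℚ ≤ s i) → (∀ i → s i ≡ 0ℚ → 0ℚ ≤ d i) →
        ∃[ δ ] 0ℚ < δ × (∀ ε → 0ℚ ≤ ε → ε ≤ δ → ∀ i → 0ℚ ≤ s i + ε * d i)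
small-steps {zero} 0≤s tight = 1ℚ , positive⁻¹ 1ℚ , λ _ _ _ ()
small-steps {suc k} 0≤s tight with small-step (0≤s zero) (tight zero) | small-steps (0≤s ∘ suc) (tight ∘ suc)
... | δ₁ , 0<δ₁ , h₁ | δ₂ , 0<δ₂ , h₂ = δ₁ ⊓ δ₂ , ⊓-pos 0<δ₁ 0<δ₂ , λ ε 0≤ε ε≤ → λ
  { zero → h₁ ε 0≤ε (≤-trans ε≤ (p⊓q≤p δ₁ δ₂)) ; (suc i) → h₂ ε 0≤ε (≤-trans ε≤ (p⊓q≤q δ₁ δ₂)) i }

-- Half of `s` absorbs the movement, the other half keeps the inequality strict.
pos-step : ∀ {s} d → 0ℚ < s → ∃[ δ ] 0ℚ < δ × (∀ ε → 0ℚ ≤ ε → ε ≤ δ → 0ℚ < s + ε * d)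
pos-step {s} d 0<s =
  let (δ , 0<δ , h) = small-step {½ * s} {d} (<⇒≤ 0<½s) (λ eq → ⊥-elim (<⇒≢ 0<½s (sym eq)))
  in δ , 0<δ , λ ε 0≤ε ε≤δ → subst (0ℚ <_) (halves s (ε * d)) (+-mono-<-≤ 0<½s (h ε 0≤ε ε≤δ))
  where
  0<½s : 0ℚ < ½ * s
  0<½s = 0<*0< (positive⁻¹ ½) 0<s
  halves : ∀ s e → ½ * s + (½ * s + e) ≡ s + e
  halves s e = trans (sym (+-assoc (½ * s) (½ * s) e))
    (cong (_+ e) (trans (sym (*-distribʳ-+ s ½ ½)) (*-identityˡ s)))

nonzero-step : ∀ {s} d → s ≢ 0ℚ → ∃[ δ ] 0ℚ < δ × (∀ ε → 0ℚ ≤ ε → ε ≤ δ → s + ε * d ≢ 0ℚ)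
nonzero-step {s} d s≢0 with <-cmp s 0ℚ
... | tri≈ _ s≡0 _ = ⊥-elim (s≢0 s≡0)
... | tri> _ _ 0<s =
  let (δ , 0<δ , h) = pos-step d 0<s in δ , 0<δ , λ ε 0≤ε ε≤δ eq → <⇒≢ (h ε 0≤ε ε≤δ) (sym eq)
... | tri< s<0 _ _ =
  let (δ , 0<δ , h) = pos-step (- d) (neg-antimono-< s<0)
  in δ , 0<δ , λ ε 0≤ε ε≤δ eq → <⇒≢ (h ε 0≤ε ε≤δ) (sym (trans (negate s ε d) (cong -_ eq)))
  where
  negate : ∀ s ε d → - s + ε * - d ≡ - (s + ε * d)
  negate = solve-∀ ℚ-ring

-- If the vector found so far lies on the hyperplane orthogonal to the next `y`, increase it
-- slightly in a coordinate where `y` is nonzero. The increase is small enough to preserve the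
-- earlier non-orthogonalities, and the strict bound `c i < s` leaves room for it.
generic : {I : Set} (K : I → (Fin k → ℚ) → Set) (Q : I → Set) (L : List I) →
          (∀ l → (∃[ y ] K l y × ∃[ i ] y i ≢ 0ℚ) ⊎ Q l) → ∀ {s} → 1ℚ < s →
          ∃[ c ] (∀ i → 1ℚ ≤ c i × c i < s) × All (λ l → (∃[ y ] K l y × y · c ≢ 0ℚ) ⊎ Q l) L
generic K Q [] dich 1<s = (λ _ → 1ℚ) , (λ _ → ≤-refl , 1<s) , []
generic {k} K Q (l ∷ L) dich {s} 1<s with generic K Q L dich 1<s | dich l
... | c , bnd , ok | inj₂ q = c , bnd , inj₂ q ∷ ok
... | c , bnd , ok | inj₁ (y , kly , i , yi≢0) with y · c ≟ 0ℚ
...   | no yc≢0 = c , bnd , inj₁ (y , kly , yc≢0) ∷ ok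
...   | yes yc≡0 =
  let (δ₁ , 0<δ₁ , below) = pos-step (- 1ℚ) (<⇒0<- (proj₂ (bnd i)))
      (δ₂ , 0<δ₂ , keep) = perturb ok
      ε = δ₁ ⊓ δ₂
      0<ε = ⊓-pos 0<δ₁ 0<δ₂
  in (λ j → c j + ε * unit i j)
   , (λ j → ≤-trans (proj₁ (bnd j)) (subst (_≤ c j + ε * unit i j) (+-identityʳ (c j))
              (+-monoʳ-≤ (c j) (0≤*0≤ (<⇒≤ 0<ε) (0≤unit i j))))
          , upper (<⇒≤ 0<ε) (below ε (<⇒≤ 0<ε) (p⊓q≤p δ₁ δ₂)) j)
   , inj₁ (y , kly , λ eq → *-≢0 (λ ε≡0 → <⇒≢ 0<ε (sym ε≡0)) yi≢0 (trans (sym (shifted ε)) eq))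
   ∷ keep ε (<⇒≤ 0<ε) (p⊓q≤q δ₁ δ₂)
  where
  Good : (Fin k → ℚ) → _ → Set
  Good c l = (∃[ y ] K l y × y · c ≢ 0ℚ) ⊎ Q l
  moved : ∀ ε z → z · (λ j → c j + ε * unit i j) ≡ z · c + ε * z i
  moved ε z = trans (·-axpy z c (unit i) ε) (cong (λ e → z · c + ε * e) (·-unitʳ z i))
  shifted : ∀ ε → y · (λ j → c j + ε * unit i j) ≡ ε * y i
  shifted ε = trans (moved ε y) (trans (cong (_+ ε * y i) yc≡0) (+-identityˡ (ε * y i)))
  upper : ∀ {ε} → 0ℚ ≤ ε → 0ℚ < s - c i + ε * - 1ℚ → ∀ j → c j + ε * unit i j < s
  upper {ε} 0≤ε h j with i Fin.≟ j
  ... | yes refl = subst₂ _<_ (trans (+-identityˡ _) (cong (λ e → c i + ε * e) (sym (unit-diag i)))) (rearrange s (c i) ε)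
                     (+-monoˡ-< (c i + ε * 1ℚ) h)
    where
    rearrange : ∀ s c ε → s - c + ε * - 1ℚ + (c + ε * 1ℚ) ≡ s
    rearrange = solve-∀ ℚ-ring
  ... | no i≢j = subst (_< s) (sym (trans (cong (λ e → c j + ε * e) (unit-off i j i≢j)) (trans (cong (c j +_) (*-zeroʳ ε)) (+-identityʳ (c j)))))
                   (proj₂ (bnd j))
  perturb : ∀ {L} → All (Good c) L →
            ∃[ δ ] 0ℚ < δ × (∀ ε → 0ℚ ≤ ε → ε ≤ δ → All (Good (λ j → c j + ε * unit i j)) L)
  perturb [] = 1ℚ , positive⁻¹ 1ℚ , λ _ _ _ → []
  perturb (inj₂ q ∷ gs) = let (δ , 0<δ , h) = perturb gs in δ , 0<δ , λ ε 0≤ε ε≤δ → inj₂ q ∷ h ε 0≤ε ε≤δ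
  perturb (inj₁ (z , klz , zc≢0) ∷ gs) =
    let (δ₁ , 0<δ₁ , h₁) = nonzero-step (z i) zc≢0
        (δ₂ , 0<δ₂ , h₂) = perturb gs
    in δ₁ ⊓ δ₂ , ⊓-pos 0<δ₁ 0<δ₂ , λ ε 0≤ε ε≤ →
       inj₁ (z , klz , λ eq → h₁ ε 0≤ε (≤-trans ε≤ (p⊓q≤p δ₁ δ₂)) (trans (sym (moved ε z)) eq))
       ∷ h₂ ε 0≤ε (≤-trans ε≤ (p⊓q≤q δ₁ δ₂))

-- Packing linear programs

record Feasible (M : Fin m → Fin k → ℚ) (c : Fin m → ℚ) (A : Subset k) (f : Fin k → ℚ) : Set where
  field
    nonneg   : ∀ e → 0ℚ ≤ f e
    inside   : Supp A f
    capacity : ∀ v → M v · f ≤ c v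

record Optimal (M : Fin m → Fin k → ℚ) (b : Fin k → ℚ) (c : Fin m → ℚ) (A : Subset k) (f : Fin k → ℚ) : Set where
  field
    feasible : Feasible M c A f
    maximal  : ∀ {g} → Feasible M c A g → b · g ≤ b · f

open Feasible
open Optimal

feasible-mono : ∀ {M : Fin m → Fin k → ℚ} {c A C f} → (∀ e → lookup A e ≡ true → lookup C e ≡ true) →
                Feasible M c A f → Feasible M c C f
feasible-mono {A = A} A⊆C F = record
  { nonneg = nonneg F
  ; inside = λ e e∉C → inside F e (e∉A e e∉C)
  ; capacity = capacity F }
  where
  e∉A : ∀ e → _ → lookup A e ≡ false
  e∉A e e∉C with lookup A e in eq
  ... | false = refl
  ... | true  = ≡true∧≡false (A⊆C e eq) e∉C

feasible-zero : ∀ {M : Fin m → Fin k → ℚ} {c A} → (∀ v → 0ℚ ≤ c v) → Feasible M c A (λ _ → 0ℚ)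
feasible-zero {M = M} {c} 0≤c = record
  { nonneg = λ _ → ≤-refl
  ; inside = λ _ _ → refl
  ; capacity = λ v → subst (_≤ c v) (sym (·-zeroʳ (M v))) (0≤c v) }

does-true : {P : Set} (d : Dec P) → does d ≡ true → P
does-true (yes p) _ = p

-- The program becomes a system of affine forms in which `valueForm` says `t ≤ b · x`, so the
-- largest feasible parameter is the maximum value.
optimum : (M : Fin m → Fin k → ℚ) (b : Fin k → ℚ) (c : Fin m → ℚ) (A : Subset k) (B : ℚ) →
          (∀ v → 0ℚ ≤ c v) → (∀ {f} → Feasible M c A f → b · f ≤ B) → ∃[ f ] Optimal M b c A f
optimum {m} {k} M b c A B 0≤c bnd =
  let (t* , f , h , max) = maximise forms 0ℚ B (λ _ → 0ℚ) zero-ok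
        (λ t x h → ≤-trans (proj₂ (from t x h)) (bnd (proj₁ (from t x h))))
  in f , record
    { feasible = proj₁ (from t* f h)
    ; maximal = λ {g} G → ≤-trans (max (b · g) g (to (b · g) g G ≤-refl)) (proj₂ (from t* f h)) }
  where
  nonnegForm outsideForm : Fin k → Form k
  nonnegForm e = (λ j → - 1ℚ * unit e j) , 0ℚ , 0ℚ
  -- Outside `A` this says `x e ≤ 0`, which together with nonnegativity gives zero. Inside `A` it
  -- repeats a constraint already present, so that the forms can be tabulated over all edges.
  outsideForm e = if lookup A e then nonnegForm e else (unit e , 0ℚ , 0ℚ)
  capacityForm : Fin m → Form k
  capacityForm v = M v , c v , 0ℚ
  valueForm : Form k
  valueForm = (λ j → - 1ℚ * b j) , 0ℚ , - 1ℚ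
  forms : List (Form k)
  forms = valueForm ∷ List.tabulate nonnegForm ++ List.tabulate outsideForm ++ List.tabulate capacityForm
  neg-dot : ∀ a (x : Fin k → ℚ) → (λ j → - 1ℚ * a j) · x ≡ - 1ℚ * a · x
  neg-dot a x = trans (·-comm _ x) (trans (·-scale x a (- 1ℚ)) (cong (- 1ℚ *_) (·-comm x a)))
  eval-nonneg : ∀ t x e → eval t x (nonnegForm e) ≡ x e
  eval-nonneg t x e = trans (cong (λ d → 0ℚ + 0ℚ * t - d) (trans (neg-dot (unit e) x) (cong (- 1ℚ *_) (·-unitˡ e x)))) (simp t (x e))
    where
    simp : ∀ t x → 0ℚ + 0ℚ * t - (- 1ℚ * x) ≡ x
    simp = solve-∀ ℚ-ring
  eval-unit : ∀ t x e → eval t x (unit e , 0ℚ , 0ℚ) ≡ 0ℚ - x e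
  eval-unit t x e = trans (cong (λ d → 0ℚ + 0ℚ * t - d) (·-unitˡ e x)) (simp t (x e))
    where
    simp : ∀ t x → 0ℚ + 0ℚ * t - x ≡ 0ℚ - x
    simp = solve-∀ ℚ-ring
  eval-capacity : ∀ t x v → eval t x (capacityForm v) ≡ c v - M v · x
  eval-capacity t x v = simp t (c v) (M v · x)
    where
    simp : ∀ t c d → c + 0ℚ * t - d ≡ c - d
    simp = solve-∀ ℚ-ring
  eval-value : ∀ t x → eval t x valueForm ≡ b · x - t
  eval-value t x = trans (cong (λ d → 0ℚ + - 1ℚ * t - d) (neg-dot b x)) (simp t (b · x))
    where
    simp : ∀ t d → 0ℚ + - 1ℚ * t - (- 1ℚ * d) ≡ d - t
    simp = solve-∀ ℚ-ring
  from : ∀ t x → Nonneg t x forms → Feasible M c A x × t ≤ b · x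
  from t x (hv ∷ hs) = record { nonneg = nn ; inside = out ; capacity = cap } , 0≤-⇒≤ (subst (0ℚ ≤_) (eval-value t x) hv)
    where
    rest = All.++⁻ʳ (List.tabulate nonnegForm) hs
    nn : ∀ e → 0ℚ ≤ x e
    nn e = subst (0ℚ ≤_) (eval-nonneg t x e) (All.tabulate⁻ (All.++⁻ˡ (List.tabulate nonnegForm) hs) e)
    out : Supp A x
    out e e∉A with lookup A e | All.tabulate⁻ (All.++⁻ˡ (List.tabulate outsideForm) rest) e
    ... | false | h = ≤-antisym (0≤-⇒≤ (subst (0ℚ ≤_) (eval-unit t x e) h)) (nn e)
    cap : ∀ v → M v · x ≤ c v
    cap v = 0≤-⇒≤ (subst (0ℚ ≤_) (eval-capacity t x v) (All.tabulate⁻ (All.++⁻ʳ (List.tabulate outsideForm) rest) v))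
  to : ∀ t x → Feasible M c A x → t ≤ b · x → Nonneg t x forms
  to t x F t≤ = subst (0ℚ ≤_) (sym (eval-value t x)) (≤⇒0≤- t≤)
    ∷ All.++⁺ (All.tabulate⁺ nn)
        (All.++⁺ (All.tabulate⁺ out)
                 (All.tabulate⁺ (λ v → subst (0ℚ ≤_) (sym (eval-capacity t x v)) (≤⇒0≤- (capacity F v)))))
    where
    nn : ∀ e → 0ℚ ≤ eval t x (nonnegForm e)
    nn e = subst (0ℚ ≤_) (sym (eval-nonneg t x e)) (nonneg F e)
    out : ∀ e → 0ℚ ≤ eval t x (outsideForm e)
    out e with lookup A e in eq
    ... | true  = nn e
    ... | false = subst (0ℚ ≤_) (sym (eval-unit t x e)) (≤⇒0≤- (≤-reflexive (inside F e eq)))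
  zero-ok : Nonneg 0ℚ (λ _ → 0ℚ) forms
  zero-ok = to 0ℚ _ (feasible-zero 0≤c) (≤-reflexive (sym (·-zeroʳ b)))

support : (Fin k → ℚ) → Subset k
support f = tabulate (λ e → not (does (f e ≟ 0ℚ)))

support-cong : {f g : Fin k → ℚ} → (∀ e → f e ≡ g e) → support f ≡ support g
support-cong f≗g = tabulate-cong (λ e → cong (λ p → not (does (p ≟ 0ℚ))) (f≗g e))

support-supp : (f : Fin k → ℚ) → Supp (support f) f
support-supp f e h with f e ≟ 0ℚ | trans (sym (lookup∘tabulate (λ e → not (does (f e ≟ 0ℚ))) e)) h
... | yes fe≡0 | _ = fe≡0

∉support : ∀ (f : Fin k → ℚ) {e} → f e ≡ 0ℚ → lookup (support f) e ≡ false
∉support f {e} fe≡0 = trans (lookup∘tabulate _ e) (cong not (dec-true (f e ≟ 0ℚ) fe≡0))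

support⊆ : ∀ A (f : Fin k → ℚ) → Supp A f → ∀ e → lookup (support f) e ≡ true → lookup A e ≡ true
support⊆ A f supp e e∈ with lookup A e in eq
... | true  = refl
... | false = ≡true∧≡false e∈ (∉support f (supp e eq))

tight : (M : Fin m → Fin k → ℚ) (c : Fin m → ℚ) (f : Fin k → ℚ) → Subset m
tight M c f = tabulate (λ v → does (M v · f ≟ c v))

∈tight : ∀ (M : Fin m → Fin k → ℚ) c f v → lookup (tight M c f) v ≡ true → M v · f ≡ c v
∈tight M c f v h = does-true (M v · f ≟ c v) (trans (sym (lookup∘tabulate _ v)) h)

tight∈ : ∀ (M : Fin m → Fin k → ℚ) c f v → M v · f ≡ c v → lookup (tight M c f) v ≡ true
tight∈ M c f v eq = trans (lookup∘tabulate _ v) (dec-true (M v · f ≟ c v) eq)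

indicator : Subset k → Fin k → ℚ
indicator A e = if lookup A e then 1ℚ else 0ℚ

unit-sym : ∀ (i j : Fin k) → unit i j ≡ unit j i
unit-sym zero    zero    = refl
unit-sym zero    (suc j) = refl
unit-sym (suc i) zero    = refl
unit-sym (suc i) (suc j) = unit-sym i j

halves-zero : ∀ {p q} → 0ℚ ≤ p → 0ℚ ≤ q → ½ * p + ½ * q ≡ 0ℚ → p ≡ 0ℚ
halves-zero {p} {q} 0≤p 0≤q eq = ≤-antisym
  (*-cancelˡ-≤-pos ½ (subst₂ _≤_ (+-identityʳ (½ * p)) (trans eq (sym (*-zeroʳ ½)))
    (+-monoʳ-≤ (½ * p) (0≤*0≤ (nonNegative⁻¹ ½) 0≤q)))) 0≤p

-- Double counting of the incidences, weighted by `f`.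
∑-columns : ∀ (M : Fin m → Fin k → ℚ) f {r} → (∀ e → ∑ (flip M e) ≡ r) → ∑ (λ v → M v · f) ≡ r * ∑ f
∑-columns M f {r} uniform = begin
  ∑ (λ v → M v · f)                   ≡⟨ ∑-swap _ ⟩
  ∑ (λ e → ∑ (λ v → M v e * f e))     ≡⟨ ∑-cong (λ e → ∑-cong (λ v → *-comm (M v e) (f e))) ⟩
  ∑ (λ e → ∑ (λ v → f e * M v e))     ≡⟨ ∑-cong (λ e → *-distribˡ-∑ (f e) (flip M e)) ⟨
  ∑ (λ e → f e * ∑ (flip M e))        ≡⟨ ∑-cong (λ e → trans (cong (f e *_) (uniform e)) (*-comm (f e) r)) ⟩
  ∑ (λ e → r * f e)                   ≡⟨ *-distribˡ-∑ r f ⟨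
  r * ∑ f                             ∎
  where open ≡-Reasoning

-- Nondegenerate optima, their bases and dual solutions

module Nondegenerate
  (M : Fin m → Fin k → ℚ) (b : Fin k → ℚ) (c : Fin m → ℚ)
  (right : ∀ T σ → (∃[ x ] InKernel T σ M x × x · b ≢ 0ℚ) ⊎ TrivialKernel T σ M)
  (left  : ∀ T σ → (∃[ y ] InKernel σ T (flip M) y × y · c ≢ 0ℚ) ⊎ TrivialKernel σ T (flip M))
  where

  -- Only the constraints tight at `f` restrict the direction; the others have slack for a short
  -- step.
  ascent-step : ∀ {A f} D → Feasible M c A f → Supp A D → (∀ e → f e ≡ 0ℚ → 0ℚ ≤ D e) →
    (∀ v → M v · f ≡ c v → M v · D ≤ 0ℚ) → ∃[ δ ] 0ℚ < δ × Feasible M c A (λ e → f e + δ * D e)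
  ascent-step {A} {f} D F D⊆A Dpos Dtight =
    let (δ₁ , 0<δ₁ , h₁) = small-steps (nonneg F) Dpos
        (δ₂ , 0<δ₂ , h₂) = small-steps {s = λ v → c v - M v · f} {d = λ v → - (M v · D)} (λ v → ≤⇒0≤- (capacity F v))
                             (λ v eq → neg-antimono-≤ (Dtight v (sym (p-q≡0⇒p≡q eq))))
        δ = δ₁ ⊓ δ₂
        0<δ = ⊓-pos 0<δ₁ 0<δ₂
    in δ , 0<δ , record
      { nonneg = h₁ δ (<⇒≤ 0<δ) (p⊓q≤p δ₁ δ₂)
      ; inside = λ e e∉A → trans (cong₂ (λ p q → p + δ * q) (inside F e e∉A) (D⊆A e e∉A)) (trans (+-identityˡ _) (*-zeroʳ δ))
      ; capacity = λ v → 0≤-⇒≤ (subst (0ℚ ≤_)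
          (trans (regroup (c v) (M v · f) δ (M v · D)) (cong (λ d → c v - d) (sym (·-axpy (M v) f D δ))))
          (h₂ δ (<⇒≤ 0<δ) (p⊓q≤q δ₁ δ₂) v)) }
    where
    regroup : ∀ c a δ d → c - a + δ * - d ≡ c - (a + δ * d)
    regroup = solve-∀ ℚ-ring

  no-ascent : ∀ {A f} D → Optimal M b c A f → Supp A D → (∀ e → f e ≡ 0ℚ → 0ℚ ≤ D e) →
    (∀ v → M v · f ≡ c v → M v · D ≤ 0ℚ) → b · D ≤ 0ℚ
  no-ascent {A} {f} D O D⊆A Dpos Dtight =
    let (δ , 0<δ , F) = ascent-step D (feasible O) D⊆A Dpos Dtight
    in *-cancelˡ-≤-pos δ {{positive 0<δ}} (subst₂ _≤_ (simp (b · f) (δ * b · D)) (trans (+-inverseʳ (b · f)) (sym (*-zeroʳ δ)))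
         (+-monoˡ-≤ (- (b · f)) (subst (_≤ b · f) (·-axpy b f D δ) (maximal O F))))
    where
    simp : ∀ a d → a + d - a ≡ d
    simp = solve-∀ ℚ-ring

  -- A kernel vector vanishes off the support and leaves the saturated vertices unchanged, so it and
  -- its negative are both admissible directions. Optimality makes it orthogonal to `b`, against
  -- genericity.
  right-trivial : ∀ {A f} → Optimal M b c A f → TrivialKernel (tight M c f) (support f) M
  right-trivial {A} {f} O with right (tight M c f) (support f)
  ... | inj₂ triv = triv
  ... | inj₁ (x , (supp , ker) , xb≢0) = ⊥-elim (xb≢0 (trans (·-comm x b) (≤-antisym b·x≤0 0≤b·x)))
    where
    x⊆A : Supp A x
    x⊆A e e∉A = supp e (∉support f (inside (feasible O) e e∉A))
    x≡0 : ∀ e → f e ≡ 0ℚ → x e ≡ 0ℚ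
    x≡0 e fe≡0 = supp e (∉support f fe≡0)
    flat : ∀ v → M v · f ≡ c v → M v · x ≡ 0ℚ
    flat v eq = ker v (tight∈ M c f v eq)
    b·x≤0 : b · x ≤ 0ℚ
    b·x≤0 = no-ascent x O x⊆A (λ e fe≡0 → ≤-reflexive (sym (x≡0 e fe≡0))) (λ v eq → ≤-reflexive (flat v eq))
    -x = λ e → - 1ℚ * x e
    0≤b·x : 0ℚ ≤ b · x
    0≤b·x = 0≤-⇒≤ (subst (0ℚ ≤_) (simp (b · x)) (≤⇒0≤- (subst (_≤ 0ℚ) (·-scale b x (- 1ℚ))
      (no-ascent -x O (λ e e∉A → cong (- 1ℚ *_) (x⊆A e e∉A))
        (λ e fe≡0 → ≤-reflexive (sym (cong (- 1ℚ *_) (x≡0 e fe≡0))))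
        (λ v eq → ≤-reflexive (trans (·-scale (M v) x (- 1ℚ)) (cong (- 1ℚ *_) (flat v eq))))))))
      where
      simp : ∀ p → 0ℚ - (- 1ℚ * p) ≡ p - 0ℚ
      simp = solve-∀ ℚ-ring

  -- On the saturated vertices `c` is the image of `f`, and `f` lives on the columns that `y`
  -- annihilates; hence `y · c` vanishes, against genericity.
  left-trivial : ∀ {f} → TrivialKernel (support f) (tight M c f) (flip M)
  left-trivial {f} with left (tight M c f) (support f)
  ... | inj₂ triv = triv
  ... | inj₁ (y , (supp , ker) , yc≢0) = ⊥-elim (yc≢0 (begin
    y · c                            ≡⟨ ·-cong-on (tight M c f) supp (∈tight M c f) ⟨
    y · (λ v → M v · f)              ≡⟨ ·-assoc y M f ⟩
    (λ e → y · flip M e) · f         ≡⟨ ·-comm _ f ⟩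
    f · (λ e → y · flip M e)         ≡⟨ ·-cong-on (support f) (support-supp f) (λ e e∈ → trans (·-comm y _) (ker e e∈)) ⟩
    f · (λ _ → 0ℚ)                   ≡⟨ ·-zeroʳ f ⟩
    0ℚ                               ∎))
    where open ≡-Reasoning

  -- The midpoint `h` is again optimal. Its support contains those of `f` and `g`, and a vertex
  -- saturated by `h` is saturated by both, so `f - g` lies in the kernel of the block of `h`.
  optimum-unique : ∀ {A f g} → Optimal M b c A f → Optimal M b c A g → ∀ e → f e ≡ g e
  optimum-unique {A} {f} {g} Of Og e = p-q≡0⇒p≡q (trans (neg-one (f e) (g e)) (right-trivial Oh diff (diff-supp , diff-ker) e))
    where
    F = feasible Of
    G = feasible Og
    h diff : Fin k → ℚ
    h e = ½ * f e + ½ * g e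
    diff e = f e + - 1ℚ * g e
    neg-one : ∀ p q → p - q ≡ p + - 1ℚ * q
    neg-one = solve-∀ ℚ-ring
    dot-h : ∀ a → a · h ≡ ½ * a · f + ½ * a · g
    dot-h a = trans (·-axpy a (λ e → ½ * f e) g ½) (cong (_+ ½ * a · g) (·-scale a f ½))
    halves : ∀ p → ½ * p + ½ * p ≡ p
    halves p = trans (sym (*-distribʳ-+ p ½ ½)) (*-identityˡ p)
    bf≡bg : b · f ≡ b · g
    bf≡bg = ≤-antisym (maximal Og F) (maximal Of G)
    Fh : Feasible M c A h
    Fh = record
      { nonneg = λ e → 0≤+0≤ (0≤*0≤ (nonNegative⁻¹ ½) (nonneg F e)) (0≤*0≤ (nonNegative⁻¹ ½) (nonneg G e))
      ; inside = λ e e∉A → cong₂ (λ p q → ½ * p + ½ * q) (inside F e e∉A) (inside G e e∉A)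
      ; capacity = λ v → subst₂ _≤_ (sym (dot-h (M v))) (halves (c v))
          (+-mono-≤ (*-monoˡ (nonNegative⁻¹ ½) (capacity F v)) (*-monoˡ (nonNegative⁻¹ ½) (capacity G v))) }
    Oh : Optimal M b c A h
    Oh = record { feasible = Fh ; maximal = λ {j} J → subst (b · j ≤_)
      (sym (trans (dot-h b) (trans (cong (λ q → ½ * b · f + ½ * q) (sym bf≡bg)) (halves (b · f))))) (maximal Of J) }
    diff-supp : Supp (support h) diff
    diff-supp e e∉ =
      let eq = support-supp h e e∉
          f≡0 = halves-zero (nonneg F e) (nonneg G e) eq
          g≡0 = halves-zero (nonneg G e) (nonneg F e) (trans (+-comm (½ * g e) _) eq)
      in cong₂ (λ p q → p + - 1ℚ * q) f≡0 g≡0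
    slack-split : ∀ c p q → ½ * (c - p) + ½ * (c - q) ≡ ½ * c + ½ * c - (½ * p + ½ * q)
    slack-split c p q = trans (cong₂ _+_ (dist ½ c p) (dist ½ c q)) (regroup (½ * c) (½ * p) (½ * q))
      where
      dist : ∀ h c p → h * (c - p) ≡ h * c - h * p
      dist = solve-∀ ℚ-ring
      regroup : ∀ c p q → c - p + (c - q) ≡ c + c - (p + q)
      regroup = solve-∀ ℚ-ring
    slack-zero : ∀ v → M v · h ≡ c v → ∀ p q → ½ * p + ½ * q ≡ M v · h → ½ * (c v - p) + ½ * (c v - q) ≡ 0ℚ
    slack-zero v eq p q eq′ = trans (slack-split (c v) p q)
      (trans (cong₂ _-_ (halves (c v)) (trans eq′ eq)) (+-inverseʳ (c v)))
    diff-ker : ∀ v → lookup (tight M c h) v ≡ true → M v · diff ≡ 0ℚ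
    diff-ker v v∈ =
      let eq = ∈tight M c h v v∈
          sf = halves-zero (≤⇒0≤- (capacity F v)) (≤⇒0≤- (capacity G v)) (slack-zero v eq _ _ (sym (dot-h (M v))))
          sg = halves-zero (≤⇒0≤- (capacity G v)) (≤⇒0≤- (capacity F v))
                 (slack-zero v eq _ _ (trans (+-comm (½ * M v · g) _) (sym (dot-h (M v)))))
      in trans (·-axpy (M v) f g (- 1ℚ))
           (trans (cong₂ (λ p q → p + - 1ℚ * q) (sym (p-q≡0⇒p≡q {c v} {M v · f} sf)) (sym (p-q≡0⇒p≡q {c v} {M v · g} sg)))
                  (trans (sym (neg-one (c v) (c v))) (+-inverseʳ (c v))))

  module Basis {A₀ f} (O₀ : Optimal M b c A₀ f) where
    σ = support f
    T = tight M c f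

    -- The block is onto because its transpose is injective: an obstruction would be a nonzero left
    -- kernel vector.
    column : ∀ v → Solution T σ M (unit v)
    column v with fredholm T σ M (unit v)
    ... | inj₁ sol = sol
    ... | inj₂ (y , supp , perp , ≢0) = ⊥-elim (≢0 (trans (·-unitʳ y v)
          (left-trivial {f} y (supp , λ j j∈σ → trans (·-comm _ y) (perp j j∈σ)) v)))

    -- Z is the inverse of the block of M with rows T and columns σ, extended by zero.
    Z : Fin m → Fin k → ℚ
    Z v = proj₁ (column v)

    Z-supp : ∀ v → Supp σ (Z v)
    Z-supp v = proj₁ (proj₂ (column v))

    MZ : ∀ v i → lookup T i ≡ true → M i · Z v ≡ unit v i
    MZ v = proj₂ (proj₂ (column v))

    Z-row-zero : ∀ v → lookup T v ≡ false → ∀ e → Z v e ≡ 0ℚ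
    Z-row-zero v v∉T = right-trivial O₀ (Z v) (Z-supp v , λ i i∈T → trans (MZ v i i∈T)
      (unit-off v i λ { refl → ≡true∧≡false i∈T v∉T }))

    -- `ZM e` holds the coordinates of column `e`, restricted to `T`, in the basis formed by the
    -- columns in `σ`.
    ZM : Fin k → Fin k → ℚ
    ZM e j = (λ v → Z v j) · flip M e

    ZM-supp : ∀ e → Supp σ (ZM e)
    ZM-supp e j j∉σ = ∑-zero (λ v → trans (cong (_* M v e) (Z-supp v j j∉σ)) (*-zeroˡ (M v e)))

    dot-ZM : ∀ a e → a · ZM e ≡ (λ v → a · Z v) · flip M e
    dot-ZM a e = ·-assoc a (λ j v → Z v j) (flip M e)

    MZM : ∀ e i → lookup T i ≡ true → M i · ZM e ≡ M i e
    MZM e i i∈T = trans (dot-ZM (M i) e)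
      (trans (∑-cong (λ v → cong (_* M v e) (trans (MZ v i i∈T) (unit-sym v i)))) (·-unitˡ i (flip M e)))

    ZM-unit : ∀ e → lookup σ e ≡ true → ∀ j → ZM e j ≡ unit e j
    ZM-unit e e∈σ j = p-q≡0⇒p≡q (trans (neg-one (ZM e j) (unit e j))
      (right-trivial O₀ (λ j → ZM e j + - 1ℚ * unit e j)
        ( (λ j j∉σ → cong₂ (λ p q → p + - 1ℚ * q) (ZM-supp e j j∉σ)
                            (unit-off e j λ { refl → ≡true∧≡false e∈σ j∉σ }))
        , (λ i i∈T → trans (·-axpy (M i) (ZM e) (unit e) (- 1ℚ))
                      (trans (cong₂ (λ p q → p + - 1ℚ * q) (MZM e i i∈T) (·-unitʳ (M i) e))
                        (trans (sym (neg-one (M i e) (M i e))) (+-inverseʳ (M i e)))))) j))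
      where
      neg-one : ∀ p q → p - q ≡ p + - 1ℚ * q
      neg-one = solve-∀ ℚ-ring

    -- tr (ZM) = tr (MZ)
    ∣σ∣≡∣T∣ : ∑ (indicator σ) ≡ ∑ (indicator T)
    ∣σ∣≡∣T∣ = begin
      ∑ (indicator σ)                              ≡⟨ ∑-cong diagσ ⟩
      ∑ (λ e → ∑ (λ v → Z v e * M v e))            ≡⟨ ∑-swap _ ⟩
      ∑ (λ v → ∑ (λ e → Z v e * M v e))            ≡⟨ ∑-cong diagT ⟨
      ∑ (indicator T)                              ∎
      where
      open ≡-Reasoning
      diagσ : ∀ e → indicator σ e ≡ ZM e e
      diagσ e with lookup σ e in eq
      ... | true  = sym (trans (ZM-unit e eq e) (unit-diag e))
      ... | false = sym (ZM-supp e e eq)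
      diagT : ∀ v → indicator T v ≡ Z v · M v
      diagT v with lookup T v in eq
      ... | true  = sym (trans (·-comm (Z v) (M v)) (trans (MZ v v eq) (unit-diag v)))
      ... | false = sym (∑-zero (λ e → trans (cong (_* M v e) (Z-row-zero v eq e)) (*-zeroˡ (M v e))))

    -- The basic dual solution: the row `b` on `σ` times the inverse block.
    dual : Fin m → ℚ
    dual v = b · Z v

    dual-supp : Supp T dual
    dual-supp v v∉T = trans (∑-cong (λ e → cong (b e *_) (Z-row-zero v v∉T e))) (·-zeroʳ b)

    -- Moving along `- Z v` relieves `v` and keeps every other saturated vertex at its load, so it
    -- is admissible; it changes the value at rate `- dual v`, which cannot be positive.
    0≤dual : ∀ v → 0ℚ ≤ dual v
    0≤dual v = 0≤-⇒≤ (subst (0ℚ ≤_) (simp (b · Z v)) (≤⇒0≤- (subst (_≤ 0ℚ) (·-scale b (Z v) (- 1ℚ))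
      (no-ascent (λ e → - 1ℚ * Z v e) O₀
        (λ e e∉A → cong (- 1ℚ *_) (Z-supp v e (∉support f (inside (feasible O₀) e e∉A))))
        (λ e fe≡0 → ≤-reflexive (sym (cong (- 1ℚ *_) (Z-supp v e (∉support f fe≡0)))))
        (λ i eq → subst (_≤ 0ℚ) (sym (trans (·-scale (M i) (Z v) (- 1ℚ)) (cong (- 1ℚ *_) (MZ v i (tight∈ M c f i eq)))))
                     (neg-unit (0≤unit v i)))))))
      where
      simp : ∀ p → 0ℚ - (- 1ℚ * p) ≡ p - 0ℚ
      simp = solve-∀ ℚ-ring
      neg-unit : ∀ {p} → 0ℚ ≤ p → - 1ℚ * p ≤ 0ℚ
      neg-unit {p} 0≤p = *-monoˡ-≤-nonPos (- 1ℚ) 0≤p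

    price : Fin k → ℚ
    price e = dual · flip M e

    price-σ : ∀ e → lookup σ e ≡ true → price e ≡ b e
    price-σ e e∈σ = trans (sym (dot-ZM b e)) (trans (∑-cong (λ j → cong (b j *_) (ZM-unit e e∈σ j))) (·-unitʳ b e))

    closure : Subset k
    closure = tabulate (λ e → does (b e ≤? price e))

    ∈closure : ∀ e → lookup closure e ≡ true → b e ≤ price e
    ∈closure e h = does-true (b e ≤? price e) (trans (sym (lookup∘tabulate _ e)) h)

    closure∈ : ∀ e → b e ≤ price e → lookup closure e ≡ true
    closure∈ e b≤ = trans (lookup∘tabulate _ e) (dec-true (b e ≤? price e) b≤)

    -- Raising f at e while staying tight on T changes the value at rate b e - price e.
    ⊆closure : ∀ {C} → Optimal M b c C f → ∀ e → lookup C e ≡ true → lookup closure e ≡ true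
    ⊆closure {C} O e e∈C = closure∈ e (0≤-⇒≤ (subst (0ℚ ≤_) (simp (b e) (price e))
      (≤⇒0≤- (subst (_≤ 0ℚ) rate (no-ascent D O D⊆C Dpos Dtight)))))
      where
      D : Fin k → ℚ
      D j = unit e j + - 1ℚ * ZM e j
      simp : ∀ b p → 0ℚ - (b + - 1ℚ * p) ≡ p - b
      simp = solve-∀ ℚ-ring
      rate : b · D ≡ b e + - 1ℚ * price e
      rate = trans (·-axpy b (unit e) (ZM e) (- 1ℚ)) (cong₂ (λ p q → p + - 1ℚ * q) (·-unitʳ b e) (dot-ZM b e))
      ZM-zero : ∀ j → f j ≡ 0ℚ → ZM e j ≡ 0ℚ
      ZM-zero j fj≡0 = ZM-supp e j (∉support f fj≡0)
      D⊆C : Supp C D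
      D⊆C j j∉C = cong₂ (λ p q → p + - 1ℚ * q) (unit-off e j λ { refl → ≡true∧≡false e∈C j∉C })
                    (ZM-zero j (inside (feasible O) j j∉C))
      Dpos : ∀ j → f j ≡ 0ℚ → 0ℚ ≤ D j
      Dpos j fj≡0 = subst (0ℚ ≤_) (sym (trans (cong (λ q → unit e j + - 1ℚ * q) (ZM-zero j fj≡0)) (+-identityʳ (unit e j)))) (0≤unit e j)
      Dtight : ∀ v → M v · f ≡ c v → M v · D ≤ 0ℚ
      Dtight v eq = ≤-reflexive (trans (·-axpy (M v) (unit e) (ZM e) (- 1ℚ))
        (trans (cong₂ (λ p q → p + - 1ℚ * q) (·-unitʳ (M v) e) (MZM e v (tight∈ M c f v eq))) (cancel (M v e))))
        where
        cancel : ∀ p → p + - 1ℚ * p ≡ 0ℚ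
        cancel = solve-∀ ℚ-ring

    -- Strong duality through complementary slackness: `dual` lives on saturated vertices, and
    -- `price` agrees with `b` on the support.
    dual·c : dual · c ≡ b · f
    dual·c = begin
      dual · c                          ≡⟨ ·-cong-on T dual-supp (∈tight M c f) ⟨
      dual · (λ v → M v · f)            ≡⟨ ·-assoc dual M f ⟩
      price · f                         ≡⟨ ·-comm price f ⟩
      f · price                         ≡⟨ ·-cong-on σ (support-supp f) price-σ ⟩
      f · b                             ≡⟨ ·-comm f b ⟩
      b · f                             ∎
      where open ≡-Reasoning

    -- On `closure` the vector `dual` is dual feasible and has the value of `f`, so weak duality
    -- bounds every competitor.
    closure-optimal : Optimal M b c closure f
    closure-optimal = record
      { feasible = record
        { nonneg = nonneg (feasible O₀) ; capacity = capacity (feasible O₀)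
        ; inside = λ e e∉ → decidable-stable (f e ≟ 0ℚ) λ fe≢0 → ≡true∧≡false
            (⊆closure O₀ e (support⊆ A₀ f (inside (feasible O₀)) e (∈support fe≢0))) e∉ }
      ; maximal = λ {g} G → begin
          b · g                            ≤⟨ ∑-mono (λ e → below G e) ⟩
          price · g                        ≡⟨ ·-assoc dual M g ⟨
          dual · (λ v → M v · g)           ≤⟨ ∑-mono (λ v → *-monoˡ (0≤dual v) (capacity G v)) ⟩
          dual · c                         ≡⟨ dual·c ⟩
          b · f                            ∎ }
      where
      open ≤-Reasoning
      ∈support : ∀ {e} → f e ≢ 0ℚ → lookup (support f) e ≡ true
      ∈support {e} fe≢0 = trans (lookup∘tabulate _ e) (cong not (dec-false (f e ≟ 0ℚ) fe≢0))
      below : ∀ {g} → Feasible M c closure g → ∀ e → b e * g e ≤ price e * g e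
      below {g} G e with lookup closure e in eq
      ... | true  = *-monoʳ (nonneg G e) (∈closure e eq)
      ... | false = ≤-reflexive (trans (cong (b e *_) (inside G e eq)) (trans (*-zeroʳ (b e))
                      (sym (trans (cong (price e *_) (inside G e eq)) (*-zeroʳ (price e))))))

    size-bound : ∀ {r} → (∀ v e → 0ℚ ≤ M v e) → (∀ e → ∑ (flip M e) ≡ r) → (∀ v → 1ℚ ≤ c v) →
                 ∑ (indicator σ) ≤ r * ∑ f
    size-bound {r} 0≤M uniform 1≤c = begin
      ∑ (indicator σ)                          ≡⟨ ∣σ∣≡∣T∣ ⟩
      ∑ (indicator T)                          ≤⟨ ∑-mono used ⟩
      ∑ (λ v → M v · f)                        ≡⟨ ∑-columns M f uniform ⟩
      r * ∑ f                                  ∎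
      where
      open ≤-Reasoning
      used : ∀ v → indicator T v ≤ M v · f
      used v with lookup T v in eq
      ... | true  = ≤-trans (1≤c v) (≤-reflexive (sym (∈tight M c f v eq)))
      ... | false = ∑-nonneg (λ e → 0≤*0≤ (0≤M v e) (nonneg (feasible O₀) e))

-- Collapsing a complex that is partitioned into intervals

_≟ˢ_ : ∀ {k} → DecidableEquality (Subset k)
_≟ˢ_ = Vec.≡-dec Bool._≟_

-- `bot A` and `top A` are the ends of the interval containing `A`. Distinct intervals may have
-- equal value; `fibre` tells them apart, since a set above `bot A` with the value of `A` must lie
-- in the interval of `A`.
module ByIntervals {k : ℕ}
  (val : Subset k → ℚ) (bot top : Subset k → Subset k)
  (val-mono : ∀ {A C} → A ⊆ C → val A ≤ val C)
  (val-pos : ∀ {A} → A ≢ ⊥ → val ⊥ < val A)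
  (bot⊆ : ∀ A → bot A ⊆ A)
  (val-bot : ∀ A → val (bot A) ≡ val A)
  (val-top : ∀ A → val (top A) ≡ val A)
  (fibre : ∀ {A C} → bot A ⊆ C → val C ≡ val A → bot C ≡ bot A × C ⊆ top A)
  where

  open Data.List.Extrema (DecTotalOrder.totalOrder ≤-decTotalOrder) using (argmax; argmax-sel; f[xs]≤f[argmax])
  open Equivalence using (to; from)

  ⊆top : ∀ A → A ⊆ top A
  ⊆top A = proj₂ (fibre (bot⊆ A) refl)

  bot⊆top : ∀ A → bot A ⊆ top A
  bot⊆top A = ⊆top A ∘ bot⊆ A

  -- The list of remaining faces stays a union of whole fibres of `bot`. Each round removes the
  -- fibre of a face of largest value, so the length of the list bounds the number of rounds.
  collapse : (d : ℤ) (fuel : ℕ) (L : List (Subset k)) → length L ℕ.≤ fuel →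
    ⊥ ∈ L →
    (∀ {A C} → C ∈ L → val A < val C → A ∈ L) →
    (∀ {A C} → C ∈ L → bot A ≡ bot C → A ∈ L) →
    (∀ {A} → A ∈ L → ℤ.+ ∣ bot A ∣ ℤ.≤ d) →
    (X : Complex k) → (∀ C → X C ⇔ (C ∈ L)) → Collapsible d X
  collapse d zero [] _ () down fib size X X⇔L
  collapse d (suc fuel) L len ⊥∈L down fib size X X⇔L = [ trivial , nontrivial ]′ (toSum (A ≟ˢ ⊥))
    where
    A : Subset k
    -- The default `⊥` is itself a remaining face, so the maximiser is one in every case.
    A = argmax val ⊥ L

    A∈L : A ∈ L
    A∈L = [ (λ eq → subst (_∈ L) (sym eq) ⊥∈L) , id ]′ (argmax-sel val ⊥ L)

    max : ∀ {C} → C ∈ L → val C ≤ val A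
    max = All.lookup (f[xs]≤f[argmax] ⊥ L)

    trivial : A ≡ ⊥ → Collapsible d X
    trivial A≡⊥ = done λ C → mk⇔
      (λ XC → decidable-stable (C ≟ˢ ⊥) λ C≢⊥ →
        <-irrefl refl (<-≤-trans (val-pos C≢⊥) (subst (λ B → val C ≤ val B) A≡⊥ (max (to (X⇔L C) XC)))))
      (λ { refl → from (X⇔L C) ⊥∈L })

    -- Maximality of `A` bounds the value from above, monotonicity over `bot A` from below.
    same-val : ∀ {C} → C ∈ L → bot A ⊆ C → val C ≡ val A
    same-val C∈L bot⊆C = ≤-antisym (max C∈L) (≤-trans (≤-reflexive (sym (val-bot A))) (val-mono bot⊆C))

    bot∈L : bot A ∈ L
    bot∈L = fib A∈L (proj₁ (fibre {A} {bot A} id (val-bot A)))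

    top∈L : top A ∈ L
    top∈L = fib A∈L (proj₁ (fibre (bot⊆top A) (val-top A)))

    ⊆top-A : ∀ C → X C → bot A ⊆ C → C ⊆ top A
    ⊆top-A C XC bot⊆C = proj₂ (fibre bot⊆C (same-val (to (X⇔L C) XC) bot⊆C))

    nontrivial : A ≢ ⊥ → Collapsible d X
    nontrivial A≢⊥ = step (bot A) (top A)
      (from (X⇔L _) bot∈L) (size A∈L)
      (from (X⇔L _) top∈L , λ ρ Xρ top⊆ρ → ⊆-antisym (⊆top-A ρ Xρ (top⊆ρ ∘ bot⊆top A)) top⊆ρ)
      (bot⊆top A)
      (λ τ (Xτ , maximal) bot⊆τ → sym (maximal (top A) (from (X⇔L _) top∈L) (⊆top-A τ Xτ bot⊆τ)))
      (collapse d fuel L′ len′ ⊥∈L′ down′ fib′ (size ∘ proj₁ ∘ ∈L′⁻) (Remove X (bot A))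
        (λ C → mk⇔ (λ (XC , ⊈) → ∈L′⁺ (to (X⇔L C) XC) ⊈)
                   (λ C∈ → from (X⇔L C) (proj₁ (∈L′⁻ C∈)) , proj₂ (∈L′⁻ C∈))))
      where
      L′ = filter (λ C → ¬? (bot A ⊆? C)) L
      ∈L′⁺ : ∀ {C} → C ∈ L → ¬ (bot A ⊆ C) → C ∈ L′
      ∈L′⁺ = ∈-filter⁺ (λ C → ¬? (bot A ⊆? C))
      ∈L′⁻ : ∀ {C} → C ∈ L′ → C ∈ L × ¬ (bot A ⊆ C)
      ∈L′⁻ = ∈-filter⁻ (λ C → ¬? (bot A ⊆? C))
      len′ : length L′ ℕ.≤ fuel
      len′ = ℕ.s≤s⁻¹ (ℕ.≤-trans (filter-notAll (λ C → ¬? (bot A ⊆? C)) L (lose A∈L (λ ¬⊆ → ¬⊆ (bot⊆ A)))) len)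
      ⊥∈L′ : ⊥ ∈ L′
      ⊥∈L′ = ∈L′⁺ ⊥∈L λ bot⊆⊥ →
        <-irrefl refl (<-≤-trans (val-pos A≢⊥) (≤-reflexive (sym (same-val ⊥∈L bot⊆⊥))))
      down′ : ∀ {B C} → C ∈ L′ → val B < val C → B ∈ L′
      down′ C∈ B<C =
        let (C∈L , _) = ∈L′⁻ C∈
            B∈L = down C∈L B<C
        in ∈L′⁺ B∈L λ bot⊆B →
           <-irrefl refl (<-≤-trans B<C (≤-trans (max C∈L) (≤-reflexive (sym (same-val B∈L bot⊆B)))))
      -- Fibres go as a whole: if `B` lies above `bot A`, then `bot B` equals `bot A`, so `C`, which
      -- contains `bot C`, was removed as well.
      fib′ : ∀ {B C} → C ∈ L′ → bot B ≡ bot C → B ∈ L′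
      fib′ {B} {C} C∈ botB≡botC =
        let (C∈L , bot⊈C) = ∈L′⁻ C∈
            B∈L = fib C∈L botB≡botC
        in ∈L′⁺ B∈L λ bot⊆B → bot⊈C (subst (_⊆ C)
             (trans (sym botB≡botC) (proj₁ (fibre bot⊆B (same-val B∈L bot⊆B)))) (bot⊆ C))

-- The matching complex

fromℕ : ℕ → ℚ
fromℕ N = ℤ.+ N / 1

-- `_/_` divides by a gcd that does not reduce for a variable `N`; this form exposes numerator and
-- denominator.
fromℕ-normal : ∀ N → fromℕ N ≡ mkℚ (ℤ.+ N) 0 (coprime-sym (1-coprimeTo N))
fromℕ-normal N = normalize-coprime (coprime-sym (1-coprimeTo N))

fromℕ-suc : ∀ N → fromℕ (suc N) ≡ 1ℚ + fromℕ N
fromℕ-suc N = sym (trans (cong (λ q → 1ℚ + q) (fromℕ-normal N)) (cong (λ z → z / 1) (cong (λ j → ℤ.+ 1 ℤ.+ j) (ℤ.*-identityʳ (ℤ.+ N)))))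

0≤fromℕ : ∀ N → 0ℚ ≤ fromℕ N
0≤fromℕ zero    = ≤-refl
0≤fromℕ (suc N) = subst (0ℚ ≤_) (sym (fromℕ-suc N)) (0≤+0≤ (nonNegative⁻¹ 1ℚ) (0≤fromℕ N))

∑-indicator : ∀ {k} (A : Subset k) → ∑ (indicator A) ≡ fromℕ ∣ A ∣
∑-indicator []          = ∑-zero (λ ())
∑-indicator (true ∷ A)  = trans (∑-suc _) (trans (cong (λ q → 1ℚ + q) (∑-indicator A)) (sym (fromℕ-suc ∣ A ∣)))
∑-indicator (false ∷ A) = trans (∑-suc _) (trans (+-identityˡ _) (∑-indicator A))

floor-*-≤ : ∀ p → floor p ℤ.* ↧ p ℤ.≤ ↥ p
floor-*-≤ p@record{} = ℤ.[n/d]*d≤n (↥ p) (↧ p)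

-- As `ceiling q` is `- floor (- q)`, it suffices that `floor (- q)` lies strictly below `- N`; the
-- strictness of `N < q` pays for the subtracted one.
<⇒≤ceiling-1 : ∀ N q → fromℕ N < q → ℤ.+ N ℤ.≤ ceiling q ℤ.- ℤ.+ 1
<⇒≤ceiling-1 N q@record{} N<q = subst (ℤ.+ N ℤ.≤_) (ℤ.+-comm (ℤ.- ℤ.+ 1) (ceiling q)) (ℤ.i<j⇒i≤pred[j]
  (subst (ℤ._< ceiling q) (ℤ.neg-involutive (ℤ.+ N)) (ℤ.neg-mono-< fl<-N)))
  where
  N′ = mkℚ (ℤ.+ N) 0 (coprime-sym (1-coprimeTo N))
  below : - q < - N′
  below = neg-antimono-< (subst (_< q) (fromℕ-normal N) N<q)
  -N : ↥ (- N′) ≡ ℤ.- ℤ.+ N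
  -N = ↥-neg N′
  den : ↧ (- N′) ≡ ℤ.+ 1
  den = ↧-neg N′
  scaled : floor (- q) ℤ.* ↧ (- q) ℤ.< (ℤ.- ℤ.+ N) ℤ.* ↧ (- q)
  scaled = ℤ.≤-<-trans (floor-*-≤ (- q))
    (subst₂ ℤ._<_ (trans (cong (↥ (- q) ℤ.*_) den) (ℤ.*-identityʳ (↥ (- q)))) (cong (ℤ._* ↧ (- q)) -N) (drop-*<* below))
  fl<-N : floor (- q) ℤ.< ℤ.- ℤ.+ N
  fl<-N = ℤ.*-cancelʳ-<-nonNeg (↧ (- q)) scaled

subsets : ∀ k → List (Subset k)
subsets zero    = [] ∷ []
subsets (suc k) = List.map (true ∷_) (subsets k) ++ List.map (false ∷_) (subsets k)

∈subsets : ∀ {k} (A : Subset k) → A ∈ subsets k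
∈subsets []          = Any.here refl
∈subsets (true ∷ A)  = ∈-++⁺ˡ (∈-map⁺ (true ∷_) (∈subsets A))
∈subsets (false ∷ A) = ∈-++⁺ʳ (List.map (true ∷_) (subsets _)) (∈-map⁺ (false ∷_) (∈subsets A))

-- Finitely many values below `n` leave a common margin; `s` limits how far the data may be
-- perturbed without pushing any of them up to `n`.
gap : {I : Set} (x : I → ℚ) (n : ℚ) (L : List I) →
      ∃[ s ] 1ℚ < s × All (λ i → x i < n → s * x i < n) L
gap {I} x n L = let (δ , 0<δ , h) = go L in 1ℚ + δ , subst (_< 1ℚ + δ) (+-identityʳ 1ℚ) (+-monoʳ-< 1ℚ 0<δ) , h δ (<⇒≤ 0<δ) ≤-refl
  where
  regroup : ∀ n x ε → n - x + ε * - x + (1ℚ + ε) * x ≡ n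
  regroup = solve-∀ ℚ-ring
  go : ∀ L → ∃[ δ ] 0ℚ < δ × (∀ ε → 0ℚ ≤ ε → ε ≤ δ → All (λ i → x i < n → (1ℚ + ε) * x i < n) L)
  go [] = 1ℚ , positive⁻¹ 1ℚ , λ _ _ _ → []
  go (i ∷ L) with go L | x i <? n
  ... | δ , 0<δ , h | no x≮n = δ , 0<δ , λ ε 0≤ε ε≤δ → (⊥-elim ∘ x≮n) ∷ h ε 0≤ε ε≤δ
  ... | δ₁ , 0<δ₁ , h₁ | yes x<n =
    let (δ₂ , 0<δ₂ , h₂) = pos-step (- x i) (<⇒0<- x<n)
    in δ₁ ⊓ δ₂ , ⊓-pos 0<δ₁ 0<δ₂ , λ ε 0≤ε ε≤ →
       (λ _ → subst₂ _<_ (+-identityˡ _) (regroup n (x i) ε)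
                (+-monoˡ-< ((1ℚ + ε) * x i) (h₂ ε 0≤ε (≤-trans ε≤ (p⊓q≤q δ₁ δ₂)))))
       ∷ h₁ ε 0≤ε (≤-trans ε≤ (p⊓q≤p δ₁ δ₂))

1·-≡∑ : ∀ {k} (f : Fin k → ℚ) → (λ _ → 1ℚ) · f ≡ ∑ f
1·-≡∑ f = ∑-cong (λ e → *-identityˡ (f e))

·-≤-scaled : ∀ {k s} {b f : Fin k → ℚ} → (∀ e → b e ≤ s) → (∀ e → 0ℚ ≤ f e) → b · f ≤ s * ∑ f
·-≤-scaled {s = s} {b} {f} b≤s 0≤f =
  ≤-trans (∑-mono (λ e → *-monoʳ (0≤f e) (b≤s e))) (≤-reflexive (sym (*-distribˡ-∑ s f)))

∑≤· : ∀ {k} {b f : Fin k → ℚ} → (∀ e → 1ℚ ≤ b e) → (∀ e → 0ℚ ≤ f e) → ∑ f ≤ b · f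
∑≤· {b = b} {f} 1≤b 0≤f = ∑-mono (λ e → subst (_≤ b e * f e) (*-identityˡ (f e)) (*-monoʳ (0≤f e) (1≤b e)))

module _ {r m k : ℕ} (H : UniformHypergraph (suc r) m k) (n : ℚ) where
  open UniformHypergraph H

  incidence : Fin m → Fin k → ℚ
  incidence v e = indicator (edge e) v

  0≤incidence : ∀ v e → 0ℚ ≤ incidence v e
  0≤incidence v e with lookup (edge e) v
  ... | true  = nonNegative⁻¹ 1ℚ
  ... | false = ≤-refl

  column-sum : ∀ e → ∑ (flip incidence e) ≡ fromℕ (suc r)
  column-sum e = trans (∑-indicator (edge e)) (cong (λ N → fromℕ N) (uniform e))

  -- Every edge has at least one vertex, so the total weight is at most the total load. This gives
  -- the a priori bound that `optimum` requires.
  ∑≤∑capacity : ∀ {c A f} → Feasible incidence c A f → ∑ f ≤ ∑ c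
  ∑≤∑capacity {c} {A} {f} F = begin
    ∑ f                              ≡⟨ +-identityʳ (∑ f) ⟨
    ∑ f + 0ℚ                         ≤⟨ +-monoʳ-≤ (∑ f) (0≤*0≤ (0≤fromℕ r) (∑-nonneg (nonneg F))) ⟩
    ∑ f + fromℕ r * ∑ f              ≡⟨ cong (_+ fromℕ r * ∑ f) (*-identityˡ (∑ f)) ⟨
    1ℚ * ∑ f + fromℕ r * ∑ f         ≡⟨ *-distribʳ-+ (∑ f) 1ℚ (fromℕ r) ⟨
    (1ℚ + fromℕ r) * ∑ f             ≡⟨ cong (_* ∑ f) (fromℕ-suc r) ⟨
    fromℕ (suc r) * ∑ f                ≡⟨ ∑-columns incidence f column-sum ⟨
    ∑ (λ v → incidence v · f)        ≤⟨ ∑-mono (capacity F) ⟩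
    ∑ c                              ∎
    where open ≤-Reasoning

  ones : ∀ {l} → Fin l → ℚ
  ones _ = 1ℚ

  -- A fractional matching of `A` may take any nonnegative values off `A`, where its sums ignore
  -- them; masking gives the representative supported on `A`.
  mask : Subset k → (Fin k → ℚ) → Fin k → ℚ
  mask A f e = if lookup A e then f e else 0ℚ

  incidence-mask : ∀ A f v →
    incidence v · mask A f ≡ ΣOver A (λ e → if lookup (edge e) v then f e else 0ℚ)
  incidence-mask A f v = trans (∑-cong term) (∑≡Σℚ _)
    where
    term : ∀ e → incidence v e * mask A f e ≡ mask A (λ e → if lookup (edge e) v then f e else 0ℚ) e
    term e with lookup A e | lookup (edge e) v
    ... | true  | true  = *-identityˡ (f e)
    ... | true  | false = *-zeroˡ (f e)
    ... | false | true  = refl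
    ... | false | false = refl

  mask-inside : ∀ A {f} → Supp A f → ∀ e → mask A f e ≡ f e
  mask-inside A supp e with lookup A e in eq
  ... | true  = refl
  ... | false = sym (supp e eq)

  matching⇒feasible : ∀ {A f} → IsFractionalMatching H A f → Feasible incidence ones A (mask A f)
  matching⇒feasible {A} {f} (0≤f , cap) = record
    { nonneg = nn ; inside = ins ; capacity = λ v → subst (_≤ 1ℚ) (sym (incidence-mask A f v)) (cap v) }
    where
    nn : ∀ e → 0ℚ ≤ mask A f e
    nn e with lookup A e
    ... | true  = 0≤f e
    ... | false = ≤-refl
    ins : Supp A (mask A f)
    ins e e∉A rewrite e∉A = refl

  feasible⇒matching : ∀ {A f} → Feasible incidence ones A f → IsFractionalMatching H A f
  feasible⇒matching {A} {f} F = nonneg F , λ v → subst (_≤ 1ℚ)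
    (trans (∑-cong (λ e → cong (incidence v e *_) (sym (mask-inside A (inside F) e)))) (incidence-mask A f v))
    (capacity F v)

  -- Opaque, since unfolding the elimination that computes an optimum is expensive.
  opaque
    maximum-matching : ∀ A → ∃[ f ] Optimal incidence ones ones A f
    maximum-matching A = optimum incidence ones ones A (∑ (ones {m})) (λ _ → nonNegative⁻¹ 1ℚ)
      (λ {f} F → ≤-trans (≤-reflexive (1·-≡∑ f)) (∑≤∑capacity F))

  ν* : Subset k → ℚ
  ν* A = ∑ (proj₁ (maximum-matching A))

  ∑≤ν* : ∀ {A g} → Feasible incidence ones A g → ∑ g ≤ ν* A
  ∑≤ν* {A} {g} G = subst₂ _≤_ (1·-≡∑ g) (1·-≡∑ _) (maximal (proj₂ (maximum-matching A)) G)

  FracMatchLess⇔ν*< : ∀ A → FracMatchLess H A n ⇔ (ν* A < n)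
  FracMatchLess⇔ν*< A = mk⇔
    (λ less → let (f , O) = maximum-matching A; F = feasible O in
       subst (_< n) (trans (sym (∑≡Σℚ _)) (∑-cong (mask-inside A (inside F)))) (less f (feasible⇒matching F)))
    (λ ν*<n f matching → ≤-<-trans (subst (_≤ ν* A) (∑≡Σℚ _) (∑≤ν* (matching⇒feasible matching))) ν*<n)

  pairs : List (Subset m × Subset k)
  pairs = cartesianProduct (subsets m) (subsets k)

  ∈pairs : ∀ T σ → (T , σ) ∈ pairs
  ∈pairs T σ = ∈-cartesianProduct⁺ (∈subsets T) (∈subsets σ)

  Left Right : Subset m × Subset k → _ → Set
  Left  (T , σ) y = InKernel σ T (flip incidence) y
  Right (T , σ) x = InKernel T σ incidence x

  module Perturbed
    {s₁ s₂ : ℚ} (1<s₁ : 1ℚ < s₁) (1<s₂ : 1ℚ < s₂)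
    (near₁ : ∀ A → ν* A < n → s₁ * ν* A < n)
    (near₂ : ∀ A → s₁ * ν* A < n → s₂ * (s₁ * ν* A) < n)
    (c : Fin m → ℚ) (c-bounds : ∀ v → 1ℚ ≤ c v × c v < s₁)
    (b : Fin k → ℚ) (b-bounds : ∀ e → 1ℚ ≤ b e × b e < s₂)
    (left : ∀ T σ → (∃[ y ] InKernel σ T (flip incidence) y × y · c ≢ 0ℚ) ⊎ TrivialKernel σ T (flip incidence))
    (right : ∀ T σ → (∃[ x ] InKernel T σ incidence x × x · b ≢ 0ℚ) ⊎ TrivialKernel T σ incidence)
    (0<n : 0ℚ < n)
    where

    open Nondegenerate incidence b c right left

    0<s₁ = <-trans (positive⁻¹ 1ℚ) 1<s₁
    0<s₂ = <-trans (positive⁻¹ 1ℚ) 1<s₂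
    1≤c = proj₁ ∘ c-bounds
    1≤b = proj₁ ∘ b-bounds

    0≤c : ∀ v → 0ℚ ≤ c v
    0≤c v = ≤-trans (nonNegative⁻¹ 1ℚ) (1≤c v)

    opaque
      best : ∀ A → ∃[ f ] Optimal incidence b c A f
      best A = optimum incidence b c A (s₂ * ∑ c) 0≤c λ F →
        ≤-trans (·-≤-scaled (<⇒≤ ∘ proj₂ ∘ b-bounds) (nonneg F)) (*-monoˡ (<⇒≤ 0<s₂) (∑≤∑capacity F))

    F* : Subset k → Fin k → ℚ
    F* A = proj₁ (best A)

    O* : ∀ A → Optimal incidence b c A (F* A)
    O* A = proj₂ (best A)

    module B A = Basis (O* A)

    val : Subset k → ℚ
    val A = b · F* A

    bot top : Subset k → Subset k
    bot A = support (F* A)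
    top A = B.closure A

    -- Dividing by `s₁` brings capacities below `s₁` down to at most one.
    ∑≤scaled-ν* : ∀ {A f} → Feasible incidence c A f → ∑ f ≤ s₁ * ν* A
    ∑≤scaled-ν* {A} {f} F = begin
      ∑ f                            ≡⟨ *-identityˡ (∑ f) ⟨
      1ℚ * ∑ f                       ≡⟨ cong (_* ∑ f) s₁u≡1 ⟨
      s₁ * u * ∑ f                   ≡⟨ *-assoc s₁ u (∑ f) ⟩
      s₁ * (u * ∑ f)                 ≡⟨ cong (s₁ *_) (*-distribˡ-∑ u f) ⟩
      s₁ * ∑ (λ e → u * f e)         ≤⟨ *-monoˡ (<⇒≤ 0<s₁) (∑≤ν* shrunk) ⟩
      s₁ * ν* A                      ∎
      where
      open ≤-Reasoning
      u = proj₁ (recip⁺ 0<s₁)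
      0<u = proj₁ (proj₂ (recip⁺ 0<s₁))
      s₁u≡1 : s₁ * u ≡ 1ℚ
      s₁u≡1 = proj₂ (proj₂ (recip⁺ 0<s₁))
      shrunk : Feasible incidence ones A (λ e → u * f e)
      shrunk = record
        { nonneg = λ e → 0≤*0≤ (<⇒≤ 0<u) (nonneg F e)
        ; inside = λ e e∉A → trans (cong (u *_) (inside F e e∉A)) (*-zeroʳ u)
        ; capacity = λ v → subst₂ _≤_ (sym (·-scale (incidence v) f u)) (trans (*-comm u s₁) s₁u≡1)
            (*-monoˡ (<⇒≤ 0<u) (≤-trans (capacity F v) (<⇒≤ (proj₂ (c-bounds v))))) }

    -- The value is squeezed as `ν* A ≤ val A ≤ s₂ * (s₁ * ν* A)`, and the two gaps keep the upper
    -- end below `n` whenever `ν* A` is.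
    X⇔val< : ∀ A → FracMatchLess H A n ⇔ (val A < n)
    X⇔val< A = mk⇔
      (λ less → ≤-<-trans
        (≤-trans (·-≤-scaled (<⇒≤ ∘ proj₂ ∘ b-bounds) (nonneg (feasible (O* A))))
                 (*-monoˡ (<⇒≤ 0<s₂) (∑≤scaled-ν* (feasible (O* A)))))
        (near₂ A (near₁ A (Equivalence.to (FracMatchLess⇔ν*< A) less))))
      (λ val<n → Equivalence.from (FracMatchLess⇔ν*< A) (≤-<-trans (ν*≤val A) val<n))
      where
      ν*≤val : ∀ A → ν* A ≤ val A
      ν*≤val A = let F = feasible (proj₂ (maximum-matching A)) in
        ≤-trans (∑≤· 1≤b (nonneg F)) (maximal (O* A) (record
          { nonneg = nonneg F ; inside = inside F ; capacity = λ v → ≤-trans (capacity F v) (1≤c v) }))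

    ⊆⇒lookup : ∀ {A C : Subset k} → A ⊆ C → ∀ e → lookup A e ≡ true → lookup C e ≡ true
    ⊆⇒lookup {A} A⊆C e h = []=⇒lookup (A⊆C (lookup⇒[]= e A h))

    lookup⇒⊆ : ∀ {A C : Subset k} → (∀ e → lookup A e ≡ true → lookup C e ≡ true) → A ⊆ C
    lookup⇒⊆ {A} {C} h {e} e∈A = lookup⇒[]= e C (h e ([]=⇒lookup e∈A))

    val-mono : ∀ {A C} → A ⊆ C → val A ≤ val C
    val-mono {A} {C} A⊆C = maximal (O* C) (feasible-mono (⊆⇒lookup A⊆C) (feasible (O* A)))

    bot⊆ : ∀ A → bot A ⊆ A
    bot⊆ A = lookup⇒⊆ (support⊆ A (F* A) (inside (feasible (O* A))))

    feasible-above : ∀ {A C} → bot A ⊆ C → Feasible incidence c C (F* A)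
    feasible-above {A} bot⊆C = feasible-mono {A = bot A} (⊆⇒lookup bot⊆C) (record
      { nonneg = nonneg (feasible (O* A)) ; inside = support-supp (F* A) ; capacity = capacity (feasible (O* A)) })

    optimal-above : ∀ {A C} → bot A ⊆ C → val C ≡ val A → Optimal incidence b c C (F* A)
    optimal-above {A} {C} bot⊆C eq = record
      { feasible = feasible-above bot⊆C ; maximal = λ {g} G → subst (b · g ≤_) eq (maximal (O* C) G) }

    val-bot : ∀ A → val (bot A) ≡ val A
    val-bot A = ≤-antisym (val-mono (bot⊆ A)) (maximal (O* (bot A)) (feasible-above id))

    val-top : ∀ A → val (top A) ≡ val A
    val-top A = ≤-antisym (maximal (B.closure-optimal A) (feasible (O* (top A))))
                          (maximal (O* (top A)) (feasible (B.closure-optimal A)))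

    -- The optimum of `A` is feasible for `C` and attains its value, so by uniqueness it is the
    -- optimum of `C`; its optimality there also places `C` inside the closure.
    fibre : ∀ {A C} → bot A ⊆ C → val C ≡ val A → bot C ≡ bot A × C ⊆ top A
    fibre {A} {C} bot⊆C eq =
      let O = optimal-above bot⊆C eq
      in support-cong (optimum-unique (O* C) O) , lookup⇒⊆ (B.⊆closure A O)

    val-⊥ : val ⊥ ≡ 0ℚ
    val-⊥ = trans (∑-cong (λ e → cong (b e *_) (inside (feasible (O* ⊥)) e (lookup-⊥ e)))) (·-zeroʳ b)
      where
      lookup-⊥ : ∀ {k} (e : Fin k) → lookup ⊥ e ≡ false
      lookup-⊥ zero    = refl
      lookup-⊥ (suc e) = lookup-⊥ e

    -- The zero function saturates no vertex because `c` is at least one, so any edge of `A` can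
    -- receive a small positive weight.
    val-pos : ∀ {A} → A ≢ ⊥ → val ⊥ < val A
    val-pos {A} A≢⊥ with nonempty? A
    ... | no empty = ⊥-elim (A≢⊥ (Empty-unique empty))
    ... | yes (e , e∈A) =
      let (δ , 0<δ , F) = ascent-step (unit e) (feasible-zero {A = A} 0≤c)
            (λ j j∉A → unit-off e j λ { refl → ≡true∧≡false ([]=⇒lookup e∈A) j∉A })
            (λ j _ → 0≤unit e j)
            (λ v eq → ⊥-elim (<⇒≢ (<-≤-trans (positive⁻¹ 1ℚ) (1≤c v)) (trans (sym (·-zeroʳ (incidence v))) eq)))
      in <-≤-trans (subst₂ _<_ (sym val-⊥) (sym (value δ)) (0<*0< 0<δ (<-≤-trans (positive⁻¹ 1ℚ) (1≤b e)))) (maximal (O* A) F)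
      where
      value : ∀ δ → b · (λ j → 0ℚ + δ * unit e j) ≡ δ * b e
      value δ = trans (·-axpy b (λ _ → 0ℚ) (unit e) δ)
        (trans (cong₂ (λ p q → p + δ * q) (·-zeroʳ b) (·-unitʳ b e)) (+-identityˡ (δ * b e)))

    size : ∀ {A} → val A < n → ℤ.+ ∣ bot A ∣ ℤ.≤ collapseDim (suc r) n
    size {A} val<n = <⇒≤ceiling-1 ∣ bot A ∣ (fromℕ (suc r) * n) (begin-strict
      fromℕ ∣ bot A ∣               ≡⟨ ∑-indicator (bot A) ⟨
      ∑ (indicator (bot A))         ≤⟨ B.size-bound A 0≤incidence column-sum 1≤c ⟩
      fromℕ (suc r) * ∑ (F* A)        ≤⟨ *-monoˡ (0≤fromℕ (suc r)) (∑≤· 1≤b (nonneg (feasible (O* A)))) ⟩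
      fromℕ (suc r) * val A           <⟨ *-monoʳ-<-pos (fromℕ (suc r)) {{positive 0<r}} val<n ⟩
      fromℕ (suc r) * n               ∎)
      where
      open ≤-Reasoning
      0<r : 0ℚ < fromℕ (suc r)
      0<r = subst (0ℚ <_) (sym (fromℕ-suc r)) (+-mono-<-≤ (positive⁻¹ 1ℚ) (0≤fromℕ r))

    collapsible : Collapsible (collapseDim (suc r) n) (LowMatchingComplex H n)
    collapsible = ByIntervals.collapse val bot top val-mono val-pos bot⊆ val-bot val-top fibre
      (collapseDim (suc r) n) (length L) L ℕ.≤-refl
      (∈L⁺ (subst (_< n) (sym val-⊥) 0<n))
      (λ C∈L A<C → ∈L⁺ (<-trans A<C (∈L⁻ C∈L)))
      (λ {A} {C} C∈L eq → ∈L⁺ (subst (_< n) (trans (sym (val-bot C)) (trans (cong val (sym eq)) (val-bot A))) (∈L⁻ C∈L)))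
      (λ A∈L → size (∈L⁻ A∈L))
      (LowMatchingComplex H n)
      (λ C → mk⇔ (∈L⁺ ∘ Equivalence.to (X⇔val< C)) (Equivalence.from (X⇔val< C) ∘ ∈L⁻))
      where
      L = filter (λ A → val A <? n) (subsets k)
      ∈L⁺ : ∀ {A} → val A < n → A ∈ L
      ∈L⁺ {A} = ∈-filter⁺ (λ A → val A <? n) (∈subsets A)
      ∈L⁻ : ∀ {A} → A ∈ L → val A < n
      ∈L⁻ A∈L = proj₂ (∈-filter⁻ (λ A → val A <? n) {xs = subsets k} A∈L)

  low-matching-collapsible : 0ℚ < n → Collapsible (collapseDim (suc r) n) (LowMatchingComplex H n)
  low-matching-collapsible 0<n =
    -- The margins are taken in succession: `s₁` for the capacities, then `s₂` for the weights
    -- within what `s₁` leaves. Genericity is imposed for all pairs at once, since the blocks that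
    -- will occur at optima depend on `b` and `c`.
    let (s₁ , 1<s₁ , near₁) = gap ν* n (subsets k)
        (s₂ , 1<s₂ , near₂) = gap (λ A → s₁ * ν* A) n (subsets k)
        (c , c-bounds , left) = generic Left (λ (T , σ) → TrivialKernel σ T (flip incidence)) pairs
          (λ (T , σ) → kernel? σ T (flip incidence)) 1<s₁
        (b , b-bounds , right) = generic Right (λ (T , σ) → TrivialKernel T σ incidence) pairs
          (λ (T , σ) → kernel? T σ incidence) 1<s₂
    in Perturbed.collapsible 1<s₁ 1<s₂
         (λ A → All.lookup near₁ (∈subsets A)) (λ A → All.lookup near₂ (∈subsets A))
         c c-bounds b b-bounds
         (λ T σ → All.lookup left (∈pairs T σ)) (λ T σ → All.lookup right (∈pairs T σ)) 0<n

theorem11 : (r : ℕ) → 2 ℕ.≤ r → (m k : ℕ) → (H : UniformHypergraph r m k) →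
    (n : ℚ) → 1ℚ < n →
    Collapsible (collapseDim r n) (LowMatchingComplex H n)
theorem11 (suc r) (s≤s _) m k H n 1<n = low-matching-collapsible H n (<-trans (positive⁻¹ 1ℚ) 1<n)
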